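{- The following identities hold in the field $\mathbb{C}((z^{ -1}))$: \begin{align*} A_{0,0}(z) & =\frac{1}{z-a_{0}^{(0)}-\sum_{i=1}^{q}\sum_{j=1}^{p}a_{0}^{(i)}a_{0}^{(-j)}\,A_{i-1,j-1}^{(1)}(z)},\\ A_{0,j}(z) & =A_{0,0}(z)\sum_{i=1}^{q} a_{0}^{(i)}A_{i-1,j-1}^{(1)}(z), \qquad j\geq 1,\\ A_{i,0}(z) & =A_{0,0}(z)\sum_{j=1}^{p} a_{0}^{(-j)}A_{i-1,j-1}^{(1)}(z), \qquad i\geq 1,\\ A_{i,j}(z) & =\frac{A_{i,0}(z)\,A_{0,j}(z)}{A_{0,0}(z)}+A^{(1)}_{i-1,j-1}(z), \qquad i, j\geq 1. \end{align*}
   Context: Fix integers $p,q\geq 1$ and, for each $-p\leq k\leq q$, a bi-infinite sequence $(a^{(k)}_{n})_{n\in\mathbb{Z}}$ of complex numbers. A step is an ordered pair $(n,m)\rightarrow(n+1,m')$ with $n\in\mathbb{Z}_{\geq 0}$, $m,m'\in\mathbb{Z}$ and $-p\leq m'-m\leq q$. Its weight is $a_m^{(i)}$ if $m'=m+i$ with $0\leq i\leq q$, and $a_{m-j}^{(-j)}$ if $m'=m-j$ with $1\leq j\leq p$. A lattice path of length $k$ is a sequence of $k$ steps in which the final vertex of each step is the initial vertex of the next; a path of length zero is a single vertex. The weight $w(\gamma)$ of a path $\gamma$ is the product of the weights of its steps (and $1$ for paths of length zero). Empty sums are zero. For $n,i,j\geq 0$: $\mathcal{D}_{[n,i,j]}$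 is the collection of all lattice paths of length $n$ with initial point $(0,i)$ and final point $(n,j)$ having no point below the $x$-axis; $\mathcal{D}^{(1)}_{[n,i,j]}$ is the subcollection of $\mathcal{D}_{[n,i+1,j+1]}$ of those paths with no point below the line $y=1$. Put $$A_{[n,i,j]}=\sum_{\gamma\in\mathcal{D}_{[n,i,j]}}w(\gamma),\qquad A^{(1)}_{[n,i,j]}=\sum_{\gamma\in\mathcal{D}^{(1)}_{[n,i,j]}}w(\gamma),$$ $$A_{i,j}(z)=\sum_{n=0}^{\infty}\frac{A_{[n,i,j]}}{z^{n+1}},\qquad A^{(1)}_{i,j}(z)=\sum_{n=0}^{\infty}\frac{A^{(1)}_{[n,i,j]}}{z^{n+1}}.$$ $\mathbb{C}((z^{ -1}))$ is the field of formal series $\sum_{n\in\mathbb{Z}}a_nz^n$ with complex coefficients and only finitely many nonzero $a_n$ with $n>0$. -}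

module Defs where

open import Level using (_⊔_; 0ℓ)
open import Algebra.Bundles using (CommutativeRing; RawMonoid)
import Algebra.Definitions
import Algebra.Structures
import Algebra.Definitions.RawMonoid
import Algebra.Properties.Monoid.Sum
open import Data.Fin.Base using (Fin; zero; suc; toℕ)
open import Data.Integer.Base as ℤ using (ℤ; +_; -[1+_]; 0ℤ; 1ℤ)
import Data.Integer.Properties as ℤ
open import Data.List.Base using (List; []; _∷_; _++_; map; concat; filter; foldr; allFin)
open import Data.List.Membership.Propositional using (_∈_)
open import Data.List.Membership.Propositional.Properties
  using (∈-map⁺; ∈-map⁻; ∈-++⁺ˡ; ∈-++⁺ʳ; ∈-concat⁺′; ∈-allFin)
open import Data.List.Relation.Unary.All as All using ([])
import Data.List.Relation.Unary.All.Properties as All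
open import Data.List.Relation.Unary.AllPairs as AllPairs using ([]; _∷_)
import Data.List.Relation.Unary.AllPairs.Properties as AllPairs
open import Data.List.Relation.Unary.Any using (here)
open import Data.List.Relation.Unary.Unique.Propositional using (Unique)
import Data.List.Relation.Unary.Unique.Propositional.Properties as Unique
open import Data.Nat.Base as ℕ using (ℕ; zero; suc)
import Data.Nat.Properties as ℕ
open import Data.Product using (∃-syntax; _×_; _,_; proj₁; proj₂)
open import Data.Product.Properties using (≡-dec)
open import Data.Rational.Base as ℚ using (ℚ; 0ℚ; 1ℚ; ½)
import Data.Rational.Properties as ℚ
open import Data.Rational.Solver using (module +-*-Solver)
open import Relation.Binary.Structures using (IsEquivalence)
open import Relation.Binary.Definitions using (DecidableEquality)
open import Relation.Binary.PropositionalEquality as ≡ using (_≡_; refl; cong; cong₂; sym; trans; subst)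
open import Relation.Nullary using (¬_; yes; no; contradiction; _×-dec_)
open import Relation.Unary using (Decidable)

------------------------------------------------------------------------
-- Real numbers: Cauchy sequences of rationals, compared by the relation
-- "the difference tends to 0".

module Real where

  Cauchy : (ℕ → ℚ) → Set
  Cauchy x = ∀ ε → 0ℚ ℚ.< ε →
    ∃[ N ] (∀ m n → N ℕ.≤ m → N ℕ.≤ n → ℚ.∣ x m ℚ.- x n ∣ ℚ.≤ ε)

  record ℝ : Set where
    no-eta-equality
    pattern
    constructor mkℝ
    field
      seq    : ℕ → ℚ
      cauchy : Cauchy seq
  open ℝ public

  infix 4 _≃_
  record _≃_ (x y : ℝ) : Set where
    constructor mk≃
    field
      close : ∀ ε → 0ℚ ℚ.< ε → ∃[ N ] (∀ n → N ℕ.≤ n → ℚ.∣ seq x n ℚ.- seq y n ∣ ℚ.≤ ε)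
  open _≃_ public

  private
    half : ∀ ε → 0ℚ ℚ.< ε → ∃[ δ ] (0ℚ ℚ.< δ × δ ℚ.+ δ ≡ ε)
    half ε ε>0 = ½ ℚ.* ε , ℚ.positive⁻¹ _ {{ℚ.pos*pos⇒pos ½ ε {{ℚ.positive ε>0}}}} ,
      trans (sym (ℚ.*-distribʳ-+ ε ½ ½)) (ℚ.*-identityˡ ε)

    scale : ∀ B ε → 0ℚ ℚ.< B → 0ℚ ℚ.< ε → ∃[ δ ] (0ℚ ℚ.< δ × B ℚ.* δ ≡ ε)
    scale B ε B>0 ε>0 = ℚ.1/_ B ℚ.* ε ,
      ℚ.positive⁻¹ _ {{ℚ.pos*pos⇒pos (ℚ.1/ B) {{ℚ.1/pos⇒pos B}} ε {{ℚ.positive ε>0}}}} ,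
      trans (sym (ℚ.*-assoc B (ℚ.1/ B) ε))
        (trans (cong (ℚ._* ε) (ℚ.*-inverseʳ B)) (ℚ.*-identityˡ ε))
      where instance
        B-pos : ℚ.Positive B
        B-pos = ℚ.positive B>0
        B-nz : ℚ.NonZero B
        B-nz = ℚ.pos⇒nonZero B

    triangle : ∀ a b c {δ δ′} → ℚ.∣ a ℚ.- b ∣ ℚ.≤ δ → ℚ.∣ b ℚ.- c ∣ ℚ.≤ δ′ →
               ℚ.∣ a ℚ.- c ∣ ℚ.≤ δ ℚ.+ δ′
    triangle a b c p q = ℚ.≤-trans
      (ℚ.≤-reflexive (cong ℚ.∣_∣
        (solve 3 (λ a b c → a :- c := (a :- b) :+ (b :- c)) refl a b c)))
      (ℚ.≤-trans (ℚ.∣p+q∣≤∣p∣+∣q∣ (a ℚ.- b) (b ℚ.- c)) (ℚ.+-mono-≤ p q))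
      where open +-*-Solver

    flip-∣-∣ : ∀ a b → ℚ.∣ a ℚ.- b ∣ ≡ ℚ.∣ b ℚ.- a ∣
    flip-∣-∣ a b = trans (cong ℚ.∣_∣
        (solve 2 (λ a b → a :- b := :- (b :- a)) refl a b)) (ℚ.∣-p∣≡∣p∣ (b ℚ.- a))
      where open +-*-Solver

    +-close : ∀ a b c d {δ δ′} → ℚ.∣ a ℚ.- c ∣ ℚ.≤ δ → ℚ.∣ b ℚ.- d ∣ ℚ.≤ δ′ →
              ℚ.∣ (a ℚ.+ b) ℚ.- (c ℚ.+ d) ∣ ℚ.≤ δ ℚ.+ δ′
    +-close a b c d p q = ℚ.≤-trans
      (ℚ.≤-reflexive (cong ℚ.∣_∣
        (solve 4 (λ a b c d → (a :+ b) :- (c :+ d) := (a :- c) :+ (b :- d)) refl a b c d)))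
      (ℚ.≤-trans (ℚ.∣p+q∣≤∣p∣+∣q∣ (a ℚ.- c) (b ℚ.- d)) (ℚ.+-mono-≤ p q))
      where open +-*-Solver

    -‿close : ∀ a b → ℚ.∣ (ℚ.- a) ℚ.- (ℚ.- b) ∣ ≡ ℚ.∣ a ℚ.- b ∣
    -‿close a b = trans (cong ℚ.∣_∣
        (solve 2 (λ a b → (:- a) :- (:- b) := b :- a) refl a b)) (flip-∣-∣ b a)
      where open +-*-Solver

    ∣*∣-mono : ∀ a b {A B} → 0ℚ ℚ.< A → ℚ.∣ a ∣ ℚ.≤ A → ℚ.∣ b ∣ ℚ.≤ B →
               ℚ.∣ a ℚ.* b ∣ ℚ.≤ A ℚ.* B
    ∣*∣-mono a b {A} A>0 p q = ℚ.≤-trans (ℚ.≤-reflexive (ℚ.∣p*q∣≡∣p∣*∣q∣ a b))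
      (ℚ.≤-trans (ℚ.*-monoʳ-≤-nonNeg ℚ.∣ b ∣ {{ℚ.∣-∣-nonNeg b}} p)
                 (ℚ.*-monoˡ-≤-nonNeg A {{ℚ.pos⇒nonNeg A {{ℚ.positive A>0}}}} q))

    *-close : ∀ a b c d {B δ} → 0ℚ ℚ.< B → ℚ.∣ a ∣ ℚ.≤ B → ℚ.∣ d ∣ ℚ.≤ B →
              ℚ.∣ a ℚ.- c ∣ ℚ.≤ δ → ℚ.∣ b ℚ.- d ∣ ℚ.≤ δ →
              ℚ.∣ (a ℚ.* b) ℚ.- (c ℚ.* d) ∣ ℚ.≤ B ℚ.* δ ℚ.+ B ℚ.* δ
    *-close a b c d B>0 ∣a∣ ∣d∣ a-c b-d = ℚ.≤-trans
      (ℚ.≤-reflexive (cong ℚ.∣_∣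
        (solve 4 (λ a b c d → (a :* b) :- (c :* d) := a :* (b :- d) :+ d :* (a :- c))
          refl a b c d)))
      (ℚ.≤-trans (ℚ.∣p+q∣≤∣p∣+∣q∣ (a ℚ.* (b ℚ.- d)) (d ℚ.* (a ℚ.- c)))
        (ℚ.+-mono-≤ (∣*∣-mono a (b ℚ.- d) B>0 ∣a∣ b-d) (∣*∣-mono d (a ℚ.- c) B>0 ∣d∣ a-c)))
      where open +-*-Solver

    eventually-bounded : ∀ (x : ℝ) →
      ∃[ B ] ∃[ N ] (0ℚ ℚ.< B × (∀ n → N ℕ.≤ n → ℚ.∣ seq x n ∣ ℚ.≤ B))
    eventually-bounded (mkℝ x c) with c 1ℚ (ℚ.positive⁻¹ 1ℚ)
    ... | N , h = 1ℚ ℚ.+ ℚ.∣ x N ∣ , N ,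
      ℚ.+-mono-<-≤ (ℚ.positive⁻¹ 1ℚ) (ℚ.0≤∣p∣ (x N)) , λ n N≤n →
      ℚ.≤-trans (ℚ.≤-reflexive (cong ℚ.∣_∣
          (solve 2 (λ a b → a := (a :- b) :+ b) refl (x n) (x N))))
        (ℚ.≤-trans (ℚ.∣p+q∣≤∣p∣+∣q∣ (x n ℚ.- x N) (x N))
          (ℚ.+-monoˡ-≤ ℚ.∣ x N ∣ (h n N N≤n ℕ.≤-refl)))
      where open +-*-Solver

    p≤p+q : ∀ p q → 0ℚ ℚ.≤ q → p ℚ.≤ p ℚ.+ q
    p≤p+q p q q≥0 = subst (ℚ._≤ p ℚ.+ q) (ℚ.+-identityʳ p) (ℚ.+-monoʳ-≤ p {0ℚ} {q} q≥0)

    q≤p+q : ∀ p q → 0ℚ ℚ.≤ p → q ℚ.≤ p ℚ.+ q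
    q≤p+q p q p≥0 = subst (ℚ._≤ p ℚ.+ q) (ℚ.+-identityˡ q) (ℚ.+-monoˡ-≤ q {0ℚ} {p} p≥0)

    jointly-bounded : ∀ (x y : ℝ) → ∃[ B ] ∃[ N ] (0ℚ ℚ.< B ×
      (∀ n → N ℕ.≤ n → ℚ.∣ seq x n ∣ ℚ.≤ B × ℚ.∣ seq y n ∣ ℚ.≤ B))
    jointly-bounded x y =
      let B₁ , N₁ , B₁>0 , h₁ = eventually-bounded x
          B₂ , N₂ , B₂>0 , h₂ = eventually-bounded y
      in B₁ ℚ.+ B₂ , N₁ ℕ.⊔ N₂ , ℚ.+-mono-< {0ℚ} {B₁} {0ℚ} {B₂} B₁>0 B₂>0 , λ n le →
        ℚ.≤-trans (h₁ n (ℕ.m⊔n≤o⇒m≤o N₁ N₂ le)) (p≤p+q B₁ B₂ (ℚ.<⇒≤ B₂>0)) ,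
        ℚ.≤-trans (h₂ n (ℕ.m⊔n≤o⇒n≤o N₁ N₂ le)) (q≤p+q B₁ B₂ (ℚ.<⇒≤ B₁>0))

  private abstract
    const-cauchy : ∀ r → Cauchy (λ _ → r)
    const-cauchy r ε ε>0 = 0 , λ _ _ _ _ →
      ℚ.≤-trans (ℚ.≤-reflexive (cong ℚ.∣_∣ (ℚ.+-inverseʳ r))) (ℚ.<⇒≤ ε>0)

    +-cauchy : ∀ x y → Cauchy (λ n → seq x n ℚ.+ seq y n)
    +-cauchy x y ε ε>0 =
      let δ , δ>0 , 2δ≡ε = half ε ε>0
          N₁ , h₁ = cauchy x δ δ>0
          N₂ , h₂ = cauchy y δ δ>0
      in N₁ ℕ.⊔ N₂ , λ m n N≤m N≤n → subst (_ ℚ.≤_) 2δ≡ε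
           (+-close (seq x m) (seq y m) (seq x n) (seq y n)
             (h₁ m n (ℕ.m⊔n≤o⇒m≤o N₁ N₂ N≤m) (ℕ.m⊔n≤o⇒m≤o N₁ N₂ N≤n))
             (h₂ m n (ℕ.m⊔n≤o⇒n≤o N₁ N₂ N≤m) (ℕ.m⊔n≤o⇒n≤o N₁ N₂ N≤n)))

    -‿cauchy : ∀ x → Cauchy (λ n → ℚ.- seq x n)
    -‿cauchy x ε ε>0 =
      let N , h = cauchy x ε ε>0
      in N , λ m n N≤m N≤n →
           ℚ.≤-trans (ℚ.≤-reflexive (-‿close (seq x m) (seq x n))) (h m n N≤m N≤n)

    *-cauchy : ∀ x y → Cauchy (λ n → seq x n ℚ.* seq y n)
    *-cauchy x y ε ε>0 =
      let η , η>0 , 2η≡ε = half ε ε>0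
          B , N₀ , B>0 , b = jointly-bounded x y
          δ , δ>0 , Bδ≡η = scale B η B>0 η>0
          N₁ , h₁ = cauchy x δ δ>0
          N₂ , h₂ = cauchy y δ δ>0
          N = N₀ ℕ.⊔ (N₁ ℕ.⊔ N₂)
          ≥N₁ = λ {n} (N≤n : N ℕ.≤ n) → ℕ.m⊔n≤o⇒m≤o N₁ N₂ (ℕ.m⊔n≤o⇒n≤o N₀ _ N≤n)
          ≥N₂ = λ {n} (N≤n : N ℕ.≤ n) → ℕ.m⊔n≤o⇒n≤o N₁ N₂ (ℕ.m⊔n≤o⇒n≤o N₀ _ N≤n)
      in N , λ m n N≤m N≤n → subst (_ ℚ.≤_) (trans (cong₂ ℚ._+_ Bδ≡η Bδ≡η) 2η≡ε)
           (*-close (seq x m) (seq y m) (seq x n) (seq y n) B>0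
             (proj₁ (b m (ℕ.m⊔n≤o⇒m≤o N₀ _ N≤m))) (proj₂ (b n (ℕ.m⊔n≤o⇒m≤o N₀ _ N≤n)))
             (h₁ m n (≥N₁ N≤m) (≥N₁ N≤n)) (h₂ m n (≥N₂ N≤m) (≥N₂ N≤n)))

  infixl 6 _+_
  infixl 7 _*_
  infix  8 -_

  fromℚ : ℚ → ℝ
  fromℚ r = mkℝ (λ _ → r) (const-cauchy r)

  _+_ : ℝ → ℝ → ℝ
  x + y = mkℝ (λ n → seq x n ℚ.+ seq y n) (+-cauchy x y)

  -_ : ℝ → ℝ
  - x = mkℝ (λ n → ℚ.- seq x n) (-‿cauchy x)

  _*_ : ℝ → ℝ → ℝ
  x * y = mkℝ (λ n → seq x n ℚ.* seq y n) (*-cauchy x y)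

  pointwise : ∀ {x y} → (∀ n → seq x n ≡ seq y n) → x ≃ y
  pointwise {x} {y} eq = mk≃ λ ε ε>0 → 0 , λ n _ →
    ℚ.≤-trans (ℚ.≤-reflexive (cong ℚ.∣_∣
      (trans (cong (ℚ._- seq y n) (eq n)) (ℚ.+-inverseʳ (seq y n))))) (ℚ.<⇒≤ ε>0)

  private
    ≃-refl : ∀ {x} → x ≃ x
    ≃-refl {x} = pointwise {x} {x} λ _ → refl

    ≃-sym : ∀ {x y} → x ≃ y → y ≃ x
    ≃-sym {x} {y} (mk≃ c) = mk≃ λ ε ε>0 →
      let N , h = c ε ε>0
      in N , λ n N≤n → ℚ.≤-trans (ℚ.≤-reflexive (flip-∣-∣ (seq y n) (seq x n))) (h n N≤n)

    ≃-trans : ∀ {x y z} → x ≃ y → y ≃ z → x ≃ z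
    ≃-trans {x} {y} {z} (mk≃ c) (mk≃ d) = mk≃ λ ε ε>0 →
      let δ , δ>0 , 2δ≡ε = half ε ε>0
          N₁ , h₁ = c δ δ>0
          N₂ , h₂ = d δ δ>0
      in N₁ ℕ.⊔ N₂ , λ n N≤n → subst (_ ℚ.≤_) 2δ≡ε
           (triangle (seq x n) (seq y n) (seq z n)
             (h₁ n (ℕ.m⊔n≤o⇒m≤o N₁ N₂ N≤n)) (h₂ n (ℕ.m⊔n≤o⇒n≤o N₁ N₂ N≤n)))

    +-cong : ∀ {x y u v} → x ≃ y → u ≃ v → x + u ≃ y + v
    +-cong {x} {y} {u} {v} (mk≃ c) (mk≃ d) = mk≃ λ ε ε>0 →
      let δ , δ>0 , 2δ≡ε = half ε ε>0
          N₁ , h₁ = c δ δ>0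
          N₂ , h₂ = d δ δ>0
      in N₁ ℕ.⊔ N₂ , λ n N≤n → subst (_ ℚ.≤_) 2δ≡ε
           (+-close (seq x n) (seq u n) (seq y n) (seq v n)
             (h₁ n (ℕ.m⊔n≤o⇒m≤o N₁ N₂ N≤n)) (h₂ n (ℕ.m⊔n≤o⇒n≤o N₁ N₂ N≤n)))

    -‿cong : ∀ {x y} → x ≃ y → - x ≃ - y
    -‿cong {x} {y} (mk≃ c) = mk≃ λ ε ε>0 →
      let N , h = c ε ε>0
      in N , λ n N≤n → ℚ.≤-trans (ℚ.≤-reflexive (-‿close (seq x n) (seq y n))) (h n N≤n)

    *-cong : ∀ {x y u v} → x ≃ y → u ≃ v → x * u ≃ y * v
    *-cong {x} {y} {u} {v} (mk≃ c) (mk≃ d) = mk≃ λ ε ε>0 →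
      let η , η>0 , 2η≡ε = half ε ε>0
          B , N₀ , B>0 , b = jointly-bounded x v
          δ , δ>0 , Bδ≡η = scale B η B>0 η>0
          N₁ , h₁ = c δ δ>0
          N₂ , h₂ = d δ δ>0
      in N₀ ℕ.⊔ (N₁ ℕ.⊔ N₂) , λ n N≤n →
           subst (_ ℚ.≤_) (trans (cong₂ ℚ._+_ Bδ≡η Bδ≡η) 2η≡ε)
           (*-close (seq x n) (seq u n) (seq y n) (seq v n) B>0
             (proj₁ (b n (ℕ.m⊔n≤o⇒m≤o N₀ _ N≤n))) (proj₂ (b n (ℕ.m⊔n≤o⇒m≤o N₀ _ N≤n)))
             (h₁ n (ℕ.m⊔n≤o⇒m≤o N₁ N₂ (ℕ.m⊔n≤o⇒n≤o N₀ _ N≤n)))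
             (h₂ n (ℕ.m⊔n≤o⇒n≤o N₁ N₂ (ℕ.m⊔n≤o⇒n≤o N₀ _ N≤n))))

    +-assoc : ∀ x y z → (x + y) + z ≃ x + (y + z)
    +-assoc x y z = pointwise {(x + y) + z} {x + (y + z)} λ n → ℚ.+-assoc (seq x n) (seq y n) (seq z n)

    +-comm : ∀ x y → x + y ≃ y + x
    +-comm x y = pointwise {x + y} {y + x} λ n → ℚ.+-comm (seq x n) (seq y n)

    +-identityˡ : ∀ x → fromℚ 0ℚ + x ≃ x
    +-identityˡ x = pointwise {fromℚ 0ℚ + x} {x} λ n → ℚ.+-identityˡ (seq x n)

    +-identityʳ : ∀ x → x + fromℚ 0ℚ ≃ x
    +-identityʳ x = pointwise {x + fromℚ 0ℚ} {x} λ n → ℚ.+-identityʳ (seq x n)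

    +-inverseˡ : ∀ x → - x + x ≃ fromℚ 0ℚ
    +-inverseˡ x = pointwise {(- x) + x} {fromℚ 0ℚ} λ n → ℚ.+-inverseˡ (seq x n)

    +-inverseʳ : ∀ x → x + - x ≃ fromℚ 0ℚ
    +-inverseʳ x = pointwise {x + - x} {fromℚ 0ℚ} λ n → ℚ.+-inverseʳ (seq x n)

    *-assoc : ∀ x y z → (x * y) * z ≃ x * (y * z)
    *-assoc x y z = pointwise {(x * y) * z} {x * (y * z)} λ n → ℚ.*-assoc (seq x n) (seq y n) (seq z n)

    *-comm : ∀ x y → x * y ≃ y * x
    *-comm x y = pointwise {x * y} {y * x} λ n → ℚ.*-comm (seq x n) (seq y n)

    *-identityˡ : ∀ x → fromℚ 1ℚ * x ≃ x
    *-identityˡ x = pointwise {fromℚ 1ℚ * x} {x} λ n → ℚ.*-identityˡ (seq x n)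

    *-identityʳ : ∀ x → x * fromℚ 1ℚ ≃ x
    *-identityʳ x = pointwise {x * fromℚ 1ℚ} {x} λ n → ℚ.*-identityʳ (seq x n)

    distribˡ : ∀ x y z → x * (y + z) ≃ x * y + x * z
    distribˡ x y z = pointwise {x * (y + z)} {x * y + x * z} λ n → ℚ.*-distribˡ-+ (seq x n) (seq y n) (seq z n)

    distribʳ : ∀ x y z → (y + z) * x ≃ y * x + z * x
    distribʳ x y z = pointwise {(y + z) * x} {y * x + z * x} λ n → ℚ.*-distribʳ-+ (seq x n) (seq y n) (seq z n)

    open Algebra.Structures _≃_

    isEquivalence : IsEquivalence _≃_
    isEquivalence = record { refl = ≃-refl ; sym = ≃-sym ; trans = ≃-trans }

    +-isMagma : IsMagma _+_
    +-isMagma = record { isEquivalence = isEquivalence ; ∙-cong = +-cong }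

    +-isSemigroup : IsSemigroup _+_
    +-isSemigroup = record { isMagma = +-isMagma ; assoc = +-assoc }

    +-isMonoid : IsMonoid _+_ (fromℚ 0ℚ)
    +-isMonoid = record { isSemigroup = +-isSemigroup ; identity = +-identityˡ , +-identityʳ }

    +-isGroup : IsGroup _+_ (fromℚ 0ℚ) -_
    +-isGroup = record
      { isMonoid = +-isMonoid ; inverse = +-inverseˡ , +-inverseʳ ; ⁻¹-cong = -‿cong }

    +-isAbelianGroup : IsAbelianGroup _+_ (fromℚ 0ℚ) -_
    +-isAbelianGroup = record { isGroup = +-isGroup ; comm = +-comm }

    isRing : IsRing _+_ _*_ -_ (fromℚ 0ℚ) (fromℚ 1ℚ)
    isRing = record
      { +-isAbelianGroup = +-isAbelianGroup
      ; *-cong = *-cong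
      ; *-assoc = *-assoc
      ; *-identity = *-identityˡ , *-identityʳ
      ; distrib = distribˡ , distribʳ }

  ℝ-commutativeRing : CommutativeRing 0ℓ 0ℓ
  ℝ-commutativeRing = record
    { Carrier = ℝ ; _≈_ = _≃_ ; _+_ = _+_ ; _*_ = _*_ ; -_ = -_
    ; 0# = fromℚ 0ℚ ; 1# = fromℚ 1ℚ
    ; isCommutativeRing = record { isRing = isRing ; *-comm = *-comm } }

------------------------------------------------------------------------
-- Complex numbers

module Complex where

  open Real
    renaming (_+_ to _+ʳ_; _*_ to _*ʳ_; -_ to -ʳ_)
    using (ℝ; seq; _≃_; fromℚ; pointwise; ℝ-commutativeRing)
  private
    module R = CommutativeRing ℝ-commutativeRing

  record ℂ : Set where
    no-eta-equality
    pattern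
    constructor _+i_
    field
      re im : ℝ
  open ℂ public

  infix 4 _≈_
  record _≈_ (z w : ℂ) : Set where
    constructor _,_
    field
      re-≃ : re z ≃ re w
      im-≃ : im z ≃ im w
  open _≈_ public

  infixl 6 _+_
  infixl 7 _*_
  infix  8 -_

  0ℂ 1ℂ : ℂ
  0ℂ = fromℚ 0ℚ +i fromℚ 0ℚ
  1ℂ = fromℚ 1ℚ +i fromℚ 0ℚ

  _+_ _*_ : ℂ → ℂ → ℂ
  z + w = (re z +ʳ re w) +i (im z +ʳ im w)
  z * w = (re z *ʳ re w +ʳ (-ʳ (im z *ʳ im w))) +i (re z *ʳ im w +ʳ im z *ʳ re w)

  -_ : ℂ → ℂ
  - z = (-ʳ re z) +i (-ʳ im z)

  private
    open Algebra.Structures _≈_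
    open +-*-Solver

    *-cong : ∀ {z z′ w w′} → z ≈ z′ → w ≈ w′ → z * w ≈ z′ * w′
    *-cong (p , q) (r , s) =
      R.+-cong (R.*-cong p r) (R.-‿cong (R.*-cong q s)) ,
      R.+-cong (R.*-cong p s) (R.*-cong q r)

    *-assoc : ∀ z w v → (z * w) * v ≈ z * (w * v)
    *-assoc z w v =
      pointwise (λ n → solve 6 (λ a b c d e f →
          (a :* c :- b :* d) :* e :- (a :* d :+ b :* c) :* f :=
          a :* (c :* e :- d :* f) :- b :* (c :* f :+ d :* e)) refl
        (seq (re z) n) (seq (im z) n) (seq (re w) n) (seq (im w) n) (seq (re v) n) (seq (im v) n)) ,
      pointwise (λ n → solve 6 (λ a b c d e f →
          (a :* c :- b :* d) :* f :+ (a :* d :+ b :* c) :* e :=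
          a :* (c :* f :+ d :* e) :+ b :* (c :* e :- d :* f)) refl
        (seq (re z) n) (seq (im z) n) (seq (re w) n) (seq (im w) n) (seq (re v) n) (seq (im v) n))

    *-comm : ∀ z w → z * w ≈ w * z
    *-comm z w =
      R.+-cong (R.*-comm _ _) (R.-‿cong (R.*-comm _ _)) ,
      R.trans (R.+-comm _ _) (R.+-cong (R.*-comm _ _) (R.*-comm _ _))

    *-identityˡ : ∀ z → 1ℂ * z ≈ z
    *-identityˡ z =
      pointwise (λ n → solve 2 (λ a b → con 1ℚ :* a :- con 0ℚ :* b := a) refl
        (seq (re z) n) (seq (im z) n)) ,
      pointwise (λ n → solve 2 (λ a b → con 1ℚ :* b :+ con 0ℚ :* a := b) refl
        (seq (re z) n) (seq (im z) n))

    distribˡ : ∀ z w v → z * (w + v) ≈ z * w + z * v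
    distribˡ z w v =
      pointwise (λ n → solve 6 (λ a b c d e f →
          a :* (c :+ e) :- b :* (d :+ f) := (a :* c :- b :* d) :+ (a :* e :- b :* f)) refl
        (seq (re z) n) (seq (im z) n) (seq (re w) n) (seq (im w) n) (seq (re v) n) (seq (im v) n)) ,
      pointwise (λ n → solve 6 (λ a b c d e f →
          a :* (d :+ f) :+ b :* (c :+ e) := (a :* d :+ b :* c) :+ (a :* f :+ b :* e)) refl
        (seq (re z) n) (seq (im z) n) (seq (re w) n) (seq (im w) n) (seq (re v) n) (seq (im v) n))

    isEquivalence : IsEquivalence _≈_
    isEquivalence = record
      { refl  = R.refl , R.refl
      ; sym   = λ (p , q) → R.sym p , R.sym q
      ; trans = λ (p , q) (r , s) → R.trans p r , R.trans q s }

    +-cong : ∀ {z z′ w w′} → z ≈ z′ → w ≈ w′ → z + w ≈ z′ + w′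
    +-cong (p , q) (r , s) = R.+-cong p r , R.+-cong q s

    open IsEquivalence isEquivalence using () renaming (refl to ≈-refl; trans to ≈-trans)

    +-isGroup : IsGroup _+_ 0ℂ -_
    +-isGroup = record
      { isMonoid = record
        { isSemigroup = record
          { isMagma = record { isEquivalence = isEquivalence ; ∙-cong = +-cong }
          ; assoc = λ _ _ _ → R.+-assoc _ _ _ , R.+-assoc _ _ _ }
        ; identity = (λ _ → R.+-identityˡ _ , R.+-identityˡ _)
                   , (λ _ → R.+-identityʳ _ , R.+-identityʳ _) }
      ; inverse = (λ _ → R.-‿inverseˡ _ , R.-‿inverseˡ _)
                , (λ _ → R.-‿inverseʳ _ , R.-‿inverseʳ _)
      ; ⁻¹-cong = λ (p , q) → R.-‿cong p , R.-‿cong q }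

    isRing : IsRing _+_ _*_ -_ 0ℂ 1ℂ
    isRing = record
      { +-isAbelianGroup = record
        { isGroup = +-isGroup ; comm = λ _ _ → R.+-comm _ _ , R.+-comm _ _ }
      ; *-cong = *-cong
      ; *-assoc = *-assoc
      ; *-identity = *-identityˡ , λ z → ≈-trans (*-comm z 1ℂ) (*-identityˡ z)
      ; distrib = distribˡ , λ z w v →
          ≈-trans (*-comm (w + v) z) (≈-trans (distribˡ z w v) (+-cong (*-comm z w) (*-comm z v))) }

  ℂ-commutativeRing : CommutativeRing 0ℓ 0ℓ
  ℂ-commutativeRing = record
    { Carrier = ℂ ; _≈_ = _≈_ ; _+_ = _+_ ; _*_ = _*_ ; -_ = -_ ; 0# = 0ℂ ; 1# = 1ℂ
    ; isCommutativeRing = record { isRing = isRing ; *-comm = *-comm } }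

open Complex public using (ℂ; ℂ-commutativeRing)

------------------------------------------------------------------------
-- The formal series Σ aₙzⁿ (n ∈ ℤ) with coefficients in K and only finitely
-- many nonzero aₙ with n > 0, i.e. K((z⁻¹)).

module LaurentSeries {c ℓ} (K : CommutativeRing c ℓ) where

  private
    module K = CommutativeRing K
    module K-Sum = Algebra.Properties.Monoid.Sum K.+-monoid

  record Laurent : Set (c ⊔ ℓ) where
    no-eta-equality
    field
      coeff  : ℤ → K.Carrier
      bound  : ℕ
      vanish : ∀ n → + bound ℤ.< n → coeff n K.≈ K.0#
  open Laurent public

  infix 4 _≋_
  record _≋_ (f g : Laurent) : Set ℓ where
    constructor mk≋
    field
      coeff-≈ : ∀ n → coeff f n K.≈ coeff g n
  open _≋_ public

  infixl 6 _+_ _-_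
  infixl 7 _*_ _/_[_]
  infix  8 -_

  const : K.Carrier → Laurent
  const x = record { coeff = coeff′ ; bound = 0 ; vanish = vanish′ }
    where
    coeff′ : ℤ → K.Carrier
    coeff′ (+ 0) = x
    coeff′ _     = K.0#

    vanish′ : ∀ n → + 0 ℤ.< n → coeff′ n K.≈ K.0#
    vanish′ (+ suc _) _           = K.refl
    vanish′ (+ 0)     (ℤ.+<+ ())

  0L 1L : Laurent
  0L = const K.0#
  1L = const K.1#

  z : Laurent
  z = record { coeff = coeff′ ; bound = 1 ; vanish = vanish′ }
    where
    coeff′ : ℤ → K.Carrier
    coeff′ (+ 1) = K.1#
    coeff′ _     = K.0#

    vanish′ : ∀ n → + 1 ℤ.< n → coeff′ n K.≈ K.0#
    vanish′ (+ suc (suc _)) _                   = K.refl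
    vanish′ (+ 0)           (ℤ.+<+ ())
    vanish′ (+ 1)           (ℤ.+<+ (ℕ.s≤s ()))

  -- ∑ᵢ t i over lo ≤ i ≤ hi; the sum is empty when hi < lo.
  ∑[_⋯_] : ℤ → ℤ → (ℤ → K.Carrier) → K.Carrier
  ∑[ lo ⋯ hi ] t = K-Sum.sum {ℤ.∣ 0ℤ ℤ.⊔ (1ℤ ℤ.+ hi ℤ.- lo) ∣} λ k → t (lo ℤ.+ + toℕ k)

  -- In the coefficient ∑ᵢ fᵢ gₙ₋ᵢ of zⁿ in a product, terms with i > bound f
  -- or n - i > bound g vanish.
  *-coeff : Laurent → Laurent → ℤ → K.Carrier
  *-coeff f g n =
    ∑[ n ℤ.- + bound g ⋯ + bound f ] λ i → coeff f i K.* coeff g (n ℤ.- i)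

  private abstract
    +-vanish : ∀ f g n → + (bound f ℕ.⊔ bound g) ℤ.< n → coeff f n K.+ coeff g n K.≈ K.0#
    +-vanish f g n lt = K.trans
      (K.+-cong
        (vanish f n (ℤ.≤-<-trans (ℤ.+≤+ (ℕ.m≤m⊔n (bound f) (bound g))) lt))
        (vanish g n (ℤ.≤-<-trans (ℤ.+≤+ (ℕ.m≤n⊔m (bound f) (bound g))) lt)))
      (K.+-identityˡ K.0#)

    -‿vanish : ∀ f n → + bound f ℤ.< n → K.- coeff f n K.≈ K.0#
    -‿vanish f n lt = K.trans (K.-‿cong (vanish f n lt))
      (K.trans (K.sym (K.+-identityˡ _)) (K.-‿inverseʳ K.0#))

    ∑-vanish : ∀ lo hi t → (∀ i → lo ℤ.≤ i → t i K.≈ K.0#) → ∑[ lo ⋯ hi ] t K.≈ K.0#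
    ∑-vanish lo hi t t≈0 = K.trans
      (K-Sum.sum-cong-≋ {len} {λ k → t (lo ℤ.+ + toℕ k)} {λ _ → K.0#}
        λ k → t≈0 _ (ℤ.i≤i+j lo (+ toℕ k)))
      (K-Sum.sum-replicate-zero len)
      where
      len : ℕ
      len = ℤ.∣ 0ℤ ℤ.⊔ (1ℤ ℤ.+ hi ℤ.- lo) ∣

    *-vanish : ∀ f g n → + (bound f ℕ.+ bound g) ℤ.< n → *-coeff f g n K.≈ K.0#
    *-vanish f g n lt = ∑-vanish (n ℤ.- + bound g) (+ bound f)
      (λ i → coeff f i K.* coeff g (n ℤ.- i)) λ i lo≤i →
        K.trans (K.*-congʳ (vanish f i (ℤ.<-≤-trans lo-large lo≤i))) (K.zeroˡ (coeff g (n ℤ.- i)))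
      where
      lo-large : + bound f ℤ.< n ℤ.- + bound g
      lo-large = subst (ℤ._< n ℤ.- + bound g)
        (trans (ℤ.+-assoc (+ bound f) (+ bound g) (ℤ.- + bound g))
          (trans (cong (ℤ._+_ (+ bound f)) (ℤ.+-inverseʳ (+ bound g)))
            (ℤ.+-identityʳ (+ bound f))))
        (ℤ.+-monoˡ-< (ℤ.- + bound g) lt)

  -_ : Laurent → Laurent
  - f = record { coeff = λ n → K.- coeff f n ; bound = bound f ; vanish = -‿vanish f }

  _+_ _-_ _*_ : Laurent → Laurent → Laurent
  f + g = record
    { coeff  = λ n → coeff f n K.+ coeff g n
    ; bound  = bound f ℕ.⊔ bound g
    ; vanish = +-vanish f g
    }
  f - g = f + (- g)
  f * g = record
    { coeff  = *-coeff f g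
    ; bound  = bound f ℕ.+ bound g
    ; vanish = *-vanish f g
    }

  rawMonoid : RawMonoid (c ⊔ ℓ) ℓ
  rawMonoid = record { Carrier = Laurent ; _≈_ = _≋_ ; _∙_ = _+_ ; ε = 0L }

  open Algebra.Definitions.RawMonoid rawMonoid public using (sum)

  Invertible : Laurent → Set (c ⊔ ℓ)
  Invertible = Algebra.Definitions.Invertible _≋_ 1L _*_

  -- Whether a series is nonzero is not decidable, so a quotient carries
  -- evidence that its denominator is a unit.
  _/_[_] : (f g : Laurent) → Invertible g → Laurent
  f / g [ u ] = f * proj₁ u

------------------------------------------------------------------------
-- Lattice paths

-- The integers -p ≤ k ≤ q by which a step may rise: up i is k = i with
-- 0 ≤ i ≤ q, and down j is k = -(j + 1) with 1 ≤ j + 1 ≤ p.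
data Shift (p q : ℕ) : Set where
  up   : Fin (suc q) → Shift p q
  down : Fin p       → Shift p q

Vertex : Set
Vertex = ℕ × ℤ

module Paths (p q : ℕ) where

  ⟦_⟧ : Shift p q → ℤ
  ⟦ up i ⟧   = + toℕ i
  ⟦ down j ⟧ = -[1+ toℕ j ]

  data Step : Vertex → Vertex → Set where
    step : ∀ {n m m′} (k : Shift p q) → m′ ≡ m ℤ.+ ⟦ k ⟧ → Step (n , m) (suc n , m′)

  infixr 5 _◅_
  data Path : ℕ → Vertex → Vertex → Set where
    ε   : ∀ {u} → Path 0 u u
    _◅_ : ∀ {n u v w} → Step u v → Path n v w → Path (suc n) u w

  -- No vertex of the path lies below the line y = c.
  Above : ∀ {n u v} → ℤ → Path n u v → Set
  Above c (ε {u})           = c ℤ.≤ proj₂ u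
  Above c (_◅_ {u = u} s γ) = c ℤ.≤ proj₂ u × Above c γ

  above? : ∀ {n u v} c → Decidable (Above {n} {u} {v} c)
  above? c (ε {u})           = c ℤ.≤? proj₂ u
  above? c (_◅_ {u = u} s γ) = (c ℤ.≤? proj₂ u) ×-dec above? c γ

  shifts : List (Shift p q)
  shifts = map up (allFin (suc q)) ++ map down (allFin p)

  _≟_ : DecidableEquality Vertex
  _≟_ = ≡-dec ℕ._≟_ ℤ._≟_

  paths : ∀ n u v → List (Path n u v)
  paths zero    u       v with u ≟ v
  ... | yes refl = ε ∷ []
  ... | no  _    = []
  paths (suc n) (x , y) v = concat
    (map (λ k → map (step k refl ◅_) (paths n (suc x , y ℤ.+ ⟦ k ⟧) v)) shifts)

  -- The list paths n u v enumerates Path n u v without repetition.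

  shifts-complete : ∀ k → k ∈ shifts
  shifts-complete (up i)   = ∈-++⁺ˡ (∈-map⁺ up (∈-allFin i))
  shifts-complete (down j) = ∈-++⁺ʳ (map up (allFin (suc q))) (∈-map⁺ down (∈-allFin j))

  shifts-unique : Unique shifts
  shifts-unique = Unique.++⁺
    (Unique.map⁺ (λ { refl → refl }) (Unique.allFin⁺ (suc q)))
    (Unique.map⁺ (λ { refl → refl }) (Unique.allFin⁺ p))
    λ { (k∈up , k∈down) → disjoint (∈-map⁻ up k∈up) (∈-map⁻ down k∈down) }
    where
    disjoint : ∀ {k} → ∃[ i ] (i ∈ allFin (suc q) × k ≡ up i) →
               ¬ (∃[ j ] (j ∈ allFin p × k ≡ down j))
    disjoint (_ , _ , refl) (_ , _ , ())

  paths-complete : ∀ {n u v} (γ : Path n u v) → γ ∈ paths n u v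
  paths-complete {u = u} ε with u ≟ u
  ... | yes refl = here refl
  ... | no  u≢u  = contradiction refl u≢u
  paths-complete (step k refl ◅ γ) =
    ∈-concat⁺′ (∈-map⁺ (step k refl ◅_) (paths-complete γ)) (∈-map⁺ _ (shifts-complete k))

  paths-unique : ∀ n u v → Unique (paths n u v)
  paths-unique zero    u       v with u ≟ v
  ... | yes refl = [] ∷ []
  ... | no  _    = []
  paths-unique (suc n) (x , y) v = Unique.concat⁺
    (All.map⁺ (All.universal (λ k → Unique.map⁺ ◅-injective (paths-unique n _ v)) shifts))
    (AllPairs.map⁺ (AllPairs.map
      (λ k≢k′ {_} (γ∈ , γ∈′) →
        k≢k′ (same-shift (∈-map⁻ (step _ refl ◅_) γ∈) (∈-map⁻ (step _ refl ◅_) γ∈′)))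
      shifts-unique))
    where
    ◅-injective : ∀ {k} {γ δ : Path n (suc x , y ℤ.+ ⟦ k ⟧) v} →
                  _≡_ {A = Path (suc n) (x , y) v} (step k refl ◅ γ) (step k refl ◅ δ) → γ ≡ δ
    ◅-injective refl = refl

    first-shift : Path (suc n) (x , y) v → Shift p q
    first-shift (step k _ ◅ _) = k

    same-shift : ∀ {k k′ γ} →
      ∃[ δ ] (δ ∈ paths n (suc x , y ℤ.+ ⟦ k ⟧) v × γ ≡ step k refl ◅ δ) →
      ∃[ δ ] (δ ∈ paths n (suc x , y ℤ.+ ⟦ k′ ⟧) v × γ ≡ step k′ refl ◅ δ) → k ≡ k′
    same-shift (_ , _ , eq) (_ , _ , eq′) = cong first-shift (trans (sym eq) eq′)

  𝒟 : ∀ n i j → List (Path n (0 , + i) (n , + j))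
  𝒟 n i j = filter (above? 0ℤ) (paths n (0 , + i) (n , + j))

  𝒟⁽¹⁾ : ∀ n i j → List (Path n (0 , + suc i) (n , + suc j))
  𝒟⁽¹⁾ n i j = filter (above? 1ℤ) (𝒟 n (suc i) (suc j))

-- a k n is the term of index n of the sequence attached to the shift k.
module WeightedPaths {c ℓ} (K : CommutativeRing c ℓ) {p q : ℕ}
  (a : Shift p q → ℤ → CommutativeRing.Carrier K) where

  open Paths p q
  open LaurentSeries K using (Laurent)
  private
    module K = CommutativeRing K

  step-weight : ∀ {u v} → Step u v → K.Carrier
  step-weight (step {m = m} (up i) _)      = a (up i) m
  step-weight (step {m′ = m-j} (down j) _) = a (down j) m-j

  weight : ∀ {n u v} → Path n u v → K.Carrier
  weight ε       = K.1#
  weight (s ◅ γ) = step-weight s K.* weight γ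

  total-weight : ∀ {n u v} → List (Path n u v) → K.Carrier
  total-weight γs = foldr K._+_ K.0# (map weight γs)

  A[_,_,_] A⁽¹⁾[_,_,_] : ℕ → ℕ → ℕ → K.Carrier
  A[ n , i , j ]    = total-weight (𝒟 n i j)
  A⁽¹⁾[ n , i , j ] = total-weight (𝒟⁽¹⁾ n i j)

  -- ∑ₙ sₙ / zⁿ⁺¹ over n ≥ 0.
  generating : (ℕ → K.Carrier) → Laurent
  generating s = record { coeff = coeff′ ; bound = 0 ; vanish = vanish′ }
    where
    coeff′ : ℤ → K.Carrier
    coeff′ (+ _)    = K.0#
    coeff′ -[1+ n ] = s n

    vanish′ : ∀ n → + 0 ℤ.< n → coeff′ n K.≈ K.0#
    vanish′ (+ _) _ = K.refl

  A A⁽¹⁾ : ℕ → ℕ → Laurent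
  A    i j = generating λ n → A[ n , i , j ]
  A⁽¹⁾ i j = generating λ n → A⁽¹⁾[ n , i , j ]

{-# OPTIONS --safe #-}
module Submission where

-- Splitting off the first step of a path gives z A_{y,v} = δ_{y,v} + ∑ₖ w(k,y) A_{y+k,v}, and
-- the same for A⁽¹⁾ at heights y ≥ 1. Such a system at the heights y ≥ 1 determines the series
-- from their values at y ≤ 0, since each coefficient is expressed through coefficients of a
-- higher power of z. Let F(y) = ∑ⱼ a₀⁽⁻ʲ⁾ A⁽¹⁾_{y-1,j-1} for y ≥ 1, F(0) = 1 and F(y) = 0 for
-- y < 0. It solves the homogeneous system, so F(y) A_{0,v} + A⁽¹⁾_{y-1,v-1} (the last term
-- being 0 if v = 0) solves the system of A_{y,v} and has the same values at y ≤ 0; hence the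
-- two agree. This gives the third identity and, substituted into the equation at y = 0, shows
-- that the denominator times A_{0,v} is δ_{0,v} + ∑ᵢ a₀⁽ⁱ⁾ A⁽¹⁾_{i-1,v-1}. The rest is
-- division by A_{0,0}, the inverse of the denominator.

open import Defs
open import Level using (_⊔_)
open import Algebra.Bundles using (CommutativeRing)
import Algebra.Properties.Ring
import Algebra.Properties.Semiring.Sum
import Algebra.Solver.Ring.NaturalCoefficients.Default
open import Data.Fin.Base using (Fin; zero; suc; toℕ)
open import Data.Fin.Properties using (toℕ<n)
open import Data.Integer.Base as ℤ using (ℤ; +_; -[1+_]; 0ℤ; 1ℤ; _⊖_)
import Data.Integer.Properties as ℤ
open import Data.Integer.Tactic.RingSolver using (solve-∀)
open import Data.List.Base using (List; []; _∷_; _++_; map; concat; filter; foldr; allFin; tabulate)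
open import Data.Nat.Base as ℕ using (ℕ; zero; suc; _≥_; _≤′_; ≤′-refl; ≤′-step)
import Data.Nat.Properties as ℕ
open import Data.Product using (Σ-syntax; ∃-syntax; _×_; _,_)
open import Data.Sum.Base using (_⊎_; inj₁; inj₂)
open import Function.Base using (_∘_; id)
import Relation.Binary.Reasoning.Setoid
open import Relation.Binary.PropositionalEquality as ≡ using (_≡_; refl; cong; cong₂; subst)
open import Relation.Nullary using (¬_; Dec; yes; no; contradiction; _×-dec_)
open import Relation.Unary using (Pred; Decidable)

-- Cauchy product of sequences.

module CauchyProduct {c ℓ} (K : CommutativeRing c ℓ) where

  open CommutativeRing K renaming (refl to ≈-refl; trans to ≈-trans; sym to ≈-sym)
  open Algebra.Properties.Semiring.Sum semiring using (sum; sum-cong-≋)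
  open Algebra.Solver.Ring.NaturalCoefficients.Default commutativeSemiring
  open Relation.Binary.Reasoning.Setoid setoid

  infixl 7 _⋆_
  infix 4 _≐_

  _≐_ : (f g : ℕ → Carrier) → Set ℓ
  f ≐ g = ∀ n → f n ≈ g n

  -- The coefficient sequence of a product of power series, by recursion on the head of the left
  -- factor, so that the ring laws follow by induction on the index. The usual finite sum is
  -- recovered in `⋆-sum`.
  _⋆_ : (f g : ℕ → Carrier) → ℕ → Carrier
  (f ⋆ g) zero    = f 0 * g 0
  (f ⋆ g) (suc n) = f 0 * g (suc n) + (f ∘ suc ⋆ g) n

  ⋆-cong : ∀ {f f′ g g′} → f ≐ f′ → g ≐ g′ → f ⋆ g ≐ f′ ⋆ g′
  ⋆-cong p q zero    = *-cong (p 0) (q 0)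
  ⋆-cong p q (suc n) = +-cong (*-cong (p 0) (q (suc n))) (⋆-cong (p ∘ suc) q n)

  -- The defining recursion peels terms off the left factor. Peeling the head off the right factor
  -- instead is what lets commutativity go through by induction.
  ⋆-sucʳ : ∀ f g n → (f ⋆ g) (suc n) ≈ g 0 * f (suc n) + (f ⋆ g ∘ suc) n
  ⋆-sucʳ f g zero    = solve 4 (λ a b c d → a :* b :+ c :* d := d :* c :+ a :* b) ≈-refl _ _ _ _
  ⋆-sucʳ f g (suc n) = ≈-trans (+-congˡ (⋆-sucʳ (f ∘ suc) g n))
    (solve 3 (λ a b c → a :+ (b :+ c) := b :+ (a :+ c)) ≈-refl _ _ _)

  ⋆-comm : ∀ f g → f ⋆ g ≐ g ⋆ f
  ⋆-comm f g zero    = *-comm _ _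
  ⋆-comm f g (suc n) = ≈-trans (+-congˡ (⋆-comm (f ∘ suc) g n)) (≈-sym (⋆-sucʳ g f n))

  ⋆-distribʳ : ∀ h f g → (λ n → f n + g n) ⋆ h ≐ (λ n → (f ⋆ h) n + (g ⋆ h) n)
  ⋆-distribʳ h f g zero    = distribʳ _ _ _
  ⋆-distribʳ h f g (suc n) = ≈-trans (+-congˡ (⋆-distribʳ h (f ∘ suc) (g ∘ suc) n))
    (solve 5 (λ a b c x y → (a :+ b) :* c :+ (x :+ y) := (a :* c :+ x) :+ (b :* c :+ y))
      ≈-refl _ _ _ _ _)

  ⋆-scaleˡ : ∀ x f g → (λ n → x * f n) ⋆ g ≐ (λ n → x * (f ⋆ g) n)
  ⋆-scaleˡ x f g zero    = *-assoc _ _ _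
  ⋆-scaleˡ x f g (suc n) = ≈-trans (+-congˡ (⋆-scaleˡ x (f ∘ suc) g n))
    (solve 4 (λ x a b c → x :* a :* b :+ x :* c := x :* (a :* b :+ c)) ≈-refl _ _ _ _)

  ⋆-assoc : ∀ f g h → (f ⋆ g) ⋆ h ≐ f ⋆ (g ⋆ h)
  ⋆-assoc f g h zero    = *-assoc _ _ _
  ⋆-assoc f g h (suc n) = begin
    f 0 * g 0 * h (suc n) + ((λ k → f 0 * g (suc k) + (f ∘ suc ⋆ g) k) ⋆ h) n
      ≈⟨ +-congˡ (⋆-distribʳ h _ _ n) ⟩
    f 0 * g 0 * h (suc n) + (((λ k → f 0 * g (suc k)) ⋆ h) n + ((f ∘ suc ⋆ g) ⋆ h) n)
      ≈⟨ +-congˡ (+-cong (⋆-scaleˡ (f 0) (g ∘ suc) h n) (⋆-assoc (f ∘ suc) g h n)) ⟩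
    f 0 * g 0 * h (suc n) + (f 0 * (g ∘ suc ⋆ h) n + (f ∘ suc ⋆ (g ⋆ h)) n)
      ≈⟨ solve 5 (λ a b c x y → a :* b :* c :+ (a :* x :+ y) := a :* (b :* c :+ x) :+ y)
           ≈-refl _ _ _ _ _ ⟩
    f 0 * (g 0 * h (suc n) + (g ∘ suc ⋆ h) n) + (f ∘ suc ⋆ (g ⋆ h)) n ∎

  ⋆-zeroˡ : ∀ {f} g → (∀ n → f n ≈ 0#) → ∀ n → (f ⋆ g) n ≈ 0#
  ⋆-zeroˡ g f≈0 zero    = ≈-trans (*-congʳ (f≈0 0)) (zeroˡ _)
  ⋆-zeroˡ g f≈0 (suc n) = ≈-trans
    (+-cong (≈-trans (*-congʳ (f≈0 0)) (zeroˡ _)) (⋆-zeroˡ g (f≈0 ∘ suc) n)) (+-identityˡ 0#)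

  ⋆-headˡ : ∀ {f} g → (∀ n → f (suc n) ≈ 0#) → ∀ n → (f ⋆ g) n ≈ f 0 * g n
  ⋆-headˡ g f≈0 zero    = ≈-refl
  ⋆-headˡ g f≈0 (suc n) = ≈-trans (+-congˡ (⋆-zeroˡ g f≈0 n)) (+-identityʳ _)

  ⋆-shiftˡ : ∀ {f} g → f 0 ≈ 0# → ∀ n → (f ⋆ g) (suc n) ≈ (f ∘ suc ⋆ g) n
  ⋆-shiftˡ g f₀≈0 n = ≈-trans (+-congʳ (≈-trans (*-congʳ f₀≈0) (zeroˡ _))) (+-identityˡ _)

  ⋆-sum : ∀ f g n → (f ⋆ g) n ≈ sum {suc n} (λ k → f (toℕ k) * g (n ℕ.∸ toℕ k))
  ⋆-sum f g zero    = ≈-sym (+-identityʳ _)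
  ⋆-sum f g (suc n) = +-congˡ (⋆-sum (f ∘ suc) g n)

-- Ring structure of Laurent series.

module LaurentRing {c ℓ} (K : CommutativeRing c ℓ) where

  open LaurentSeries K
  open CauchyProduct K
  private
    module K where
      open CommutativeRing K public
      open Algebra.Properties.Semiring.Sum semiring public
  open Relation.Binary.Reasoning.Setoid K.setoid

  above-or-below : ∀ b n → (+ b ℤ.< n) ⊎ (∃[ k ] n ≡ b ⊖ k)
  above-or-below b n with n ℤ.≤? + b
  ... | no  n≰b = inj₁ (ℤ.≰⇒> n≰b)
  ... | yes n≤b = inj₂ (ℤ.∣ + b ℤ.- n ∣ , n≡)
    where
    cancel : ∀ i j → i ≡ j ℤ.- (j ℤ.- i)
    cancel = solve-∀

    n≡ : n ≡ b ⊖ ℤ.∣ + b ℤ.- n ∣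
    n≡ = ≡.trans (cancel n (+ b)) (≡.trans
      (cong (ℤ._-_ (+ b)) (≡.sym (ℤ.0≤i⇒+∣i∣≡i (ℤ.i≤j⇒0≤j-i n≤b))))
      (ℤ.m-n≡m⊖n b ℤ.∣ + b ℤ.- n ∣))

  -- Reading coefficients downwards from `z` to the power `b` turns a series without higher terms
  -- into a power series in the inverse of `z`. Products of Laurent series then become Cauchy
  -- products, and their ring laws are inherited.
  descending : Laurent → ℕ → ℕ → K.Carrier
  descending f b k = coeff f (b ⊖ k)

  descending-shift : ∀ f b k → descending f (suc b) (suc k) ≡ descending f b k
  descending-shift f b k = cong (coeff f) (ℤ.[1+m]⊖[1+n]≡m⊖n b k)

  ≋-descending : ∀ {f g b} → bound f ℕ.≤ b → bound g ℕ.≤ b →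
    descending f b ≐ descending g b → f ≋ g
  ≋-descending {f} {g} {b} f≤b g≤b eq = mk≋ λ n → case n (above-or-below b n)
    where
    case : ∀ n → (+ b ℤ.< n) ⊎ (∃[ k ] n ≡ b ⊖ k) → coeff f n K.≈ coeff g n
    case n (inj₁ b<n) = K.trans (vanish f n (ℤ.≤-<-trans (ℤ.+≤+ f≤b) b<n))
      (K.sym (vanish g n (ℤ.≤-<-trans (ℤ.+≤+ g≤b) b<n)))
    case _ (inj₂ (k , refl)) = eq k

  private
    -- The summation range of `*-coeff` has exactly `k + 1` terms. Its index runs upwards through
    -- the coefficients of `f`, hence downwards through those of `g`: the term number `t` pairs
    -- depth `t` in `g` with depth `k - t` in `f`. The factors therefore appear in reverse order and
    -- are swapped at the end.
    *-descending₀ : ∀ f g k → coeff (f * g) ((bound f ℕ.+ bound g) ⊖ k) K.≈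
                    (descending f (bound f) ⋆ descending g (bound g)) k
    *-descending₀ f g k = begin
      K.sum {ℤ.∣ 0ℤ ℤ.⊔ (1ℤ ℤ.+ + b ℤ.- lo) ∣} (h ∘ toℕ)
        ≡⟨ cong (λ l → K.sum {l} (h ∘ toℕ)) len ⟩
      K.sum {suc k} (h ∘ toℕ)
        ≈⟨ K.sum-cong-≋ {suc k} (λ t → K.trans (K.*-comm _ _) (K.reflexive (cong₂ K._*_
             (cong (coeff g) (at-g (toℕ t)))
             (cong (coeff f) (at-f (toℕ t) (toℕ≤k t)))))) ⟩
      K.sum {suc k} (λ t → descending g c′ (toℕ t) K.* descending f b (k ℕ.∸ toℕ t))
        ≈⟨ ⋆-sum (descending g c′) (descending f b) k ⟨
      (descending g c′ ⋆ descending f b) k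
        ≈⟨ ⋆-comm (descending g c′) (descending f b) k ⟩
      (descending f b ⋆ descending g c′) k ∎
      where
      b = bound f
      c′ = bound g
      n = (b ℕ.+ c′) ⊖ k
      lo = n ℤ.- + c′

      n≡ : n ≡ + b ℤ.+ + c′ ℤ.- + k
      n≡ = ≡.sym (ℤ.m-n≡m⊖n (b ℕ.+ c′) k)

      h : ℕ → K.Carrier
      h t = coeff f (lo ℤ.+ + t) K.* coeff g (n ℤ.- (lo ℤ.+ + t))

      toℕ≤k : ∀ (t : Fin (suc k)) → toℕ t ℕ.≤ k
      toℕ≤k t = ℕ.≤-pred (toℕ<n t)

      len : ℤ.∣ 0ℤ ℤ.⊔ (1ℤ ℤ.+ + b ℤ.- lo) ∣ ≡ suc k
      len = cong (λ i → ℤ.∣ 0ℤ ℤ.⊔ i ∣) (≡.trans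
        (cong (λ n → 1ℤ ℤ.+ + b ℤ.- (n ℤ.- + c′)) n≡) (lemma (+ b) (+ c′) (+ k)))
        where
        lemma : ∀ b c k → 1ℤ ℤ.+ b ℤ.- (b ℤ.+ c ℤ.- k ℤ.- c) ≡ 1ℤ ℤ.+ k
        lemma = solve-∀

      at-g : ∀ t → n ℤ.- (lo ℤ.+ + t) ≡ c′ ⊖ t
      at-g t = ≡.trans (lemma n (+ c′) (+ t)) (ℤ.m-n≡m⊖n c′ t)
        where
        lemma : ∀ n c t → n ℤ.- (n ℤ.- c ℤ.+ t) ≡ c ℤ.- t
        lemma = solve-∀

      at-f : ∀ t → t ℕ.≤ k → lo ℤ.+ + t ≡ b ⊖ (k ℕ.∸ t)
      at-f t t≤k = ≡.trans (cong (λ n → n ℤ.- + c′ ℤ.+ + t) n≡) (≡.trans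
        (lemma (+ b) (+ c′) (+ k) (+ t)) (≡.trans
        (cong (ℤ._-_ (+ b)) (≡.trans (ℤ.m-n≡m⊖n k t) (ℤ.⊖-≥ t≤k)))
        (ℤ.m-n≡m⊖n b (k ℕ.∸ t))))
        where
        lemma : ∀ b c k t → b ℤ.+ c ℤ.- k ℤ.- c ℤ.+ t ≡ b ℤ.- (k ℤ.- t)
        lemma = solve-∀

    -- Equal series may carry different bounds, so the product has to be readable from any common
    -- upper bounds. Raising such a bound by one puts a zero in front of the descending sequence,
    -- which `⋆-shiftˡ` removes again. The induction uses `≤′` because it is built by raising the
    -- upper bound.
    *-descending′ : ∀ f g {b c′} → bound f ≤′ b → bound g ≤′ c′ → ∀ k →
      coeff (f * g) ((b ℕ.+ c′) ⊖ k) K.≈ (descending f b ⋆ descending g c′) k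
    *-descending′ f g ≤′-refl ≤′-refl k = *-descending₀ f g k
    *-descending′ f g {b} {suc c′} ≤′-refl (≤′-step q) zero = K.trans
      (vanish (f * g) _ (ℤ.+<+ (ℕ.+-monoʳ-< b (ℕ.s≤s (ℕ.≤′⇒≤ q)))))
      (K.sym (K.trans (K.*-congˡ (vanish g _ (ℤ.+<+ (ℕ.s≤s (ℕ.≤′⇒≤ q))))) (K.zeroʳ _)))
    *-descending′ f g {b} {suc c′} p@≤′-refl (≤′-step q) (suc k) = begin
      coeff (f * g) ((b ℕ.+ suc c′) ⊖ suc k)
        ≡⟨ cong (coeff (f * g)) (≡.trans (cong (_⊖ suc k) (ℕ.+-suc b c′)) (ℤ.[1+m]⊖[1+n]≡m⊖n _ k)) ⟩
      coeff (f * g) ((b ℕ.+ c′) ⊖ k)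
        ≈⟨ *-descending′ f g p q k ⟩
      (descending f b ⋆ descending g c′) k
        ≈⟨ ⋆-comm (descending f b) (descending g c′) k ⟩
      (descending g c′ ⋆ descending f b) k
        ≈⟨ ⋆-cong (λ k → K.reflexive (≡.sym (descending-shift g c′ k))) (λ _ → K.refl) k ⟩
      (descending g (suc c′) ∘ suc ⋆ descending f b) k
        ≈⟨ ⋆-shiftˡ {descending g (suc c′)} _ (vanish g _ (ℤ.+<+ (ℕ.s≤s (ℕ.≤′⇒≤ q)))) k ⟨
      (descending g (suc c′) ⋆ descending f b) (suc k)
        ≈⟨ ⋆-comm (descending g (suc c′)) (descending f b) (suc k) ⟩
      (descending f b ⋆ descending g (suc c′)) (suc k) ∎
    *-descending′ f g {suc b} {c′} (≤′-step p) q zero = K.trans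
      (vanish (f * g) _ (ℤ.+<+ (ℕ.s≤s (ℕ.+-mono-≤ (ℕ.≤′⇒≤ p) (ℕ.≤′⇒≤ q)))))
      (K.sym (K.trans (K.*-congʳ (vanish f _ (ℤ.+<+ (ℕ.s≤s (ℕ.≤′⇒≤ p))))) (K.zeroˡ _)))
    *-descending′ f g {suc b} {c′} (≤′-step p) q (suc k) = begin
      coeff (f * g) ((suc b ℕ.+ c′) ⊖ suc k)
        ≡⟨ cong (coeff (f * g)) (ℤ.[1+m]⊖[1+n]≡m⊖n (b ℕ.+ c′) k) ⟩
      coeff (f * g) ((b ℕ.+ c′) ⊖ k)
        ≈⟨ *-descending′ f g p q k ⟩
      (descending f b ⋆ descending g c′) k
        ≈⟨ ⋆-cong (λ k → K.reflexive (≡.sym (descending-shift f b k))) (λ _ → K.refl) k ⟩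
      (descending f (suc b) ∘ suc ⋆ descending g c′) k
        ≈⟨ ⋆-shiftˡ {descending f (suc b)} _ (vanish f _ (ℤ.+<+ (ℕ.s≤s (ℕ.≤′⇒≤ p)))) k ⟨
      (descending f (suc b) ⋆ descending g c′) (suc k) ∎

  *-descending : ∀ f g {b c′} → bound f ℕ.≤ b → bound g ℕ.≤ c′ →
    descending (f * g) (b ℕ.+ c′) ≐ descending f b ⋆ descending g c′
  *-descending f g p q = *-descending′ f g (ℕ.≤⇒≤′ p) (ℕ.≤⇒≤′ q)

  *-cong : ∀ {f f′ g g′} → f ≋ f′ → g ≋ g′ → f * g ≋ f′ * g′
  *-cong {f} {f′} {g} {g′} p q = ≋-descending
    (ℕ.+-mono-≤ f≤ g≤) (ℕ.+-mono-≤ f′≤ g′≤) λ k → K.trans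
      (*-descending f g f≤ g≤ k) (K.trans
      (⋆-cong (λ k → coeff-≈ p _) (λ k → coeff-≈ q _) k)
      (K.sym (*-descending f′ g′ f′≤ g′≤ k)))
    where
    f≤  = ℕ.m≤m⊔n (bound f) (bound f′)
    f′≤ = ℕ.m≤n⊔m (bound f) (bound f′)
    g≤  = ℕ.m≤m⊔n (bound g) (bound g′)
    g′≤ = ℕ.m≤n⊔m (bound g) (bound g′)

  *-comm : ∀ f g → f * g ≋ g * f
  *-comm f g = ≋-descending ℕ.≤-refl (ℕ.≤-reflexive (ℕ.+-comm (bound g) (bound f))) λ k → K.trans
    (*-descending f g ℕ.≤-refl ℕ.≤-refl k) (K.trans
    (⋆-comm (descending f (bound f)) (descending g (bound g)) k) (K.trans
    (K.sym (*-descending g f ℕ.≤-refl ℕ.≤-refl k))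
    (K.reflexive (cong (λ b → descending (g * f) b k) (ℕ.+-comm (bound g) (bound f))))))

  *-assoc : ∀ f g h → (f * g) * h ≋ f * (g * h)
  *-assoc f g h = ≋-descending ℕ.≤-refl (ℕ.≤-reflexive (≡.sym assoc)) λ k → begin
    descending ((f * g) * h) (bound f ℕ.+ bound g ℕ.+ bound h) k
      ≈⟨ *-descending (f * g) h ℕ.≤-refl ℕ.≤-refl k ⟩
    (descending (f * g) (bound f ℕ.+ bound g) ⋆ H) k
      ≈⟨ ⋆-cong (*-descending f g ℕ.≤-refl ℕ.≤-refl) (λ _ → K.refl) k ⟩
    (F ⋆ G ⋆ H) k
      ≈⟨ ⋆-assoc F G H k ⟩
    (F ⋆ (G ⋆ H)) k
      ≈⟨ ⋆-cong (λ _ → K.refl) (*-descending g h ℕ.≤-refl ℕ.≤-refl) k ⟨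
    (F ⋆ descending (g * h) (bound g ℕ.+ bound h)) k
      ≈⟨ *-descending f (g * h) ℕ.≤-refl ℕ.≤-refl k ⟨
    descending (f * (g * h)) (bound f ℕ.+ (bound g ℕ.+ bound h)) k
      ≡⟨ cong (λ b → descending (f * (g * h)) b k) assoc ⟨
    descending (f * (g * h)) (bound f ℕ.+ bound g ℕ.+ bound h) k ∎
    where
    F = descending f (bound f)
    G = descending g (bound g)
    H = descending h (bound h)
    assoc = ℕ.+-assoc (bound f) (bound g) (bound h)

  *-distribʳ-+ : ∀ h f g → (f + g) * h ≋ f * h + g * h
  *-distribʳ-+ h f g = ≋-descending ℕ.≤-refl
    (ℕ.⊔-lub (ℕ.+-monoˡ-≤ (bound h) f≤) (ℕ.+-monoˡ-≤ (bound h) g≤)) λ k → K.trans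
    (*-descending (f + g) h ℕ.≤-refl ℕ.≤-refl k) (K.trans
    (⋆-distribʳ (descending h (bound h)) (descending f b) (descending g b) k)
    (K.sym (K.+-cong (*-descending f h f≤ ℕ.≤-refl k) (*-descending g h g≤ ℕ.≤-refl k))))
    where
    b = bound f ℕ.⊔ bound g
    f≤ = ℕ.m≤m⊔n (bound f) (bound g)
    g≤ = ℕ.m≤n⊔m (bound f) (bound g)

  coeff-const-* : ∀ x f n → coeff (const x * f) n K.≈ x K.* coeff f n
  coeff-const-* x f n = case (above-or-below (bound f) n)
    where
    case : (+ bound f ℤ.< n) ⊎ (∃[ k ] n ≡ bound f ⊖ k) → coeff (const x * f) n K.≈ x K.* coeff f n
    case (inj₁ b<n) = K.trans (vanish (const x * f) n b<n)
      (K.sym (K.trans (K.*-congˡ (vanish f n b<n)) (K.zeroʳ x)))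
    case (inj₂ (k , refl)) = K.trans (*-descending (const x) f ℕ.≤-refl ℕ.≤-refl k)
      (⋆-headˡ {descending (const x) 0} _ (λ _ → K.refl) k)

  coeff-z-* : ∀ f n → coeff (z * f) n K.≈ coeff f (ℤ.pred n)
  coeff-z-* f n = case (above-or-below (suc (bound f)) n)
    where
    descending-z : ∀ k → descending z 1 (suc k) K.≈ K.0#
    descending-z k rewrite ℤ.[1+m]⊖[1+n]≡m⊖n 0 k with k
    ... | zero  = K.refl
    ... | suc _ = K.refl

    case : (+ suc (bound f) ℤ.< n) ⊎ (∃[ k ] n ≡ suc (bound f) ⊖ k) →
           coeff (z * f) n K.≈ coeff f (ℤ.pred n)
    case (inj₁ b<n) = K.trans (vanish (z * f) n b<n)
      (K.sym (vanish f (ℤ.pred n) (ℤ.suc[i]≤j⇒i<j (ℤ.i<j⇒i≤pred[j] b<n))))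
    case (inj₂ (k , refl)) = K.trans (*-descending z f ℕ.≤-refl ℕ.≤-refl k) (K.trans
      (⋆-headˡ {descending z 1} _ descending-z k) (K.trans
      (K.*-identityˡ _)
      (K.reflexive (cong (coeff f) (≡.sym pred-⊖)))))
      where
      pred-⊖ : ℤ.pred (suc (bound f) ⊖ k) ≡ bound f ⊖ k
      pred-⊖ = ≡.trans (ℤ.distribʳ-⊖-+-neg 0 (suc (bound f)) k) (ℤ.[1+m]⊖[1+n]≡m⊖n (bound f) k)

  coeff-0L : ∀ n → coeff 0L n K.≈ K.0#
  coeff-0L (+ zero)  = K.refl
  coeff-0L (+ suc _) = K.refl
  coeff-0L -[1+ _ ]  = K.refl

  laurentRing : CommutativeRing (c ⊔ ℓ) ℓ
  laurentRing = record
    { Carrier = Laurent ; _≈_ = _≋_ ; _+_ = _+_ ; _*_ = _*_ ; -_ = -_ ; 0# = 0L ; 1# = 1L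
    ; isCommutativeRing = record
      { isRing = record
        { +-isAbelianGroup = record
          { isGroup = record
            { isMonoid = record
              { isSemigroup = record
                { isMagma = record
                  { isEquivalence = record
                    { refl  = mk≋ λ _ → K.refl
                    ; sym   = λ p → mk≋ λ n → K.sym (coeff-≈ p n)
                    ; trans = ≋-trans }
                  ; ∙-cong = λ p q → mk≋ λ n → K.+-cong (coeff-≈ p n) (coeff-≈ q n) }
                ; assoc = λ f g h → mk≋ λ n → K.+-assoc _ _ _ }
              ; identity = (λ f → ≋-trans (+-comm 0L f) (+-identityʳ f)) , +-identityʳ }
            ; inverse = (λ f → ≋-trans (+-comm (- f) f) (+-inverseʳ f)) , +-inverseʳ
            ; ⁻¹-cong = λ p → mk≋ λ n → K.-‿cong (coeff-≈ p n) }
          ; comm = +-comm }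
        ; *-cong = *-cong
        ; *-assoc = *-assoc
        ; *-identity = *-identityˡ , λ f → ≋-trans (*-comm f 1L) (*-identityˡ f)
        ; distrib = (λ f g h → ≋-trans (*-comm f (g + h)) (≋-trans (*-distribʳ-+ f g h)
            (mk≋ λ n → K.+-cong (coeff-≈ (*-comm g f) n) (coeff-≈ (*-comm h f) n)))) , *-distribʳ-+ }
      ; *-comm = *-comm } }
    where
    ≋-trans : ∀ {f g h} → f ≋ g → g ≋ h → f ≋ h
    ≋-trans p q = mk≋ λ n → K.trans (coeff-≈ p n) (coeff-≈ q n)

    +-comm : ∀ f g → f + g ≋ g + f
    +-comm f g = mk≋ λ n → K.+-comm _ _

    +-identityʳ : ∀ f → f + 0L ≋ f
    +-identityʳ f = mk≋ λ n → K.trans (K.+-congˡ (coeff-0L n)) (K.+-identityʳ _)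

    +-inverseʳ : ∀ f → f - f ≋ 0L
    +-inverseʳ f = mk≋ λ n → K.trans (K.-‿inverseʳ _) (K.sym (coeff-0L n))

    *-identityˡ : ∀ f → 1L * f ≋ f
    *-identityˡ f = mk≋ λ n → K.trans (coeff-const-* K.1# f n) (K.*-identityˡ _)

-- Finite sums over shifts and linear recurrences.

module ShiftSum {c ℓ} (R : CommutativeRing c ℓ) {p q : ℕ} where

  open CommutativeRing R renaming (refl to ≈-refl; trans to ≈-trans; sym to ≈-sym)
  open Algebra.Properties.Semiring.Sum semiring
  open Algebra.Solver.Ring.NaturalCoefficients.Default commutativeSemiring

  ∑ₛ : (Shift p q → Carrier) → Carrier
  ∑ₛ f = sum (f ∘ up) + sum (f ∘ down)

  sum-zero : ∀ {n} {f : Fin n → Carrier} → (∀ i → f i ≈ 0#) → sum f ≈ 0#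
  sum-zero {n} f≈0 = ≈-trans (sum-cong-≋ f≈0) (sum-replicate-zero n)

  ∑ₛ-cong : ∀ {f g} → (∀ k → f k ≈ g k) → ∑ₛ f ≈ ∑ₛ g
  ∑ₛ-cong eq = +-cong (sum-cong-≋ (eq ∘ up)) (sum-cong-≋ (eq ∘ down))

  ∑ₛ-zero : ∀ {f} → (∀ k → f k ≈ 0#) → ∑ₛ f ≈ 0#
  ∑ₛ-zero f≈0 = ≈-trans (+-cong (sum-zero (f≈0 ∘ up)) (sum-zero (f≈0 ∘ down))) (+-identityˡ 0#)

  ∑ₛ-distrib-+ : ∀ f g → ∑ₛ (λ k → f k + g k) ≈ ∑ₛ f + ∑ₛ g
  ∑ₛ-distrib-+ f g = ≈-trans
    (+-cong (∑-distrib-+ (f ∘ up) (g ∘ up)) (∑-distrib-+ (f ∘ down) (g ∘ down)))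
    (solve 4 (λ a b c d → (a :+ b) :+ (c :+ d) := (a :+ c) :+ (b :+ d)) ≈-refl _ _ _ _)

  ∑ₛ-*ˡ : ∀ x f → x * ∑ₛ f ≈ ∑ₛ (λ k → x * f k)
  ∑ₛ-*ˡ x f = ≈-trans (distribˡ x _ _)
    (+-cong (*-distribˡ-sum x (f ∘ up)) (*-distribˡ-sum x (f ∘ down)))

  ∑ₛ-*ʳ : ∀ x f → ∑ₛ f * x ≈ ∑ₛ (λ k → f k * x)
  ∑ₛ-*ʳ x f = ≈-trans (distribʳ x _ _)
    (+-cong (*-distribʳ-sum x (f ∘ up)) (*-distribʳ-sum x (f ∘ down)))

  ∑ₛ-∑-comm : ∀ {n} (f : Shift p q → Fin n → Carrier) →
    ∑ₛ (λ k → sum (f k)) ≈ sum (λ i → ∑ₛ (λ k → f k i))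
  ∑ₛ-∑-comm f = ≈-trans (+-cong (∑-comm (f ∘ up)) (∑-comm (f ∘ down)))
    (≈-sym (∑-distrib-+ (λ i → sum (λ k → f (up k) i)) (λ i → sum (λ k → f (down k) i))))

-- The linear algebra is done in an abstract ring because conversion checking on the concrete
-- operations of Laurent series, which unfold, is prohibitively slow.
module LinearRecurrence {c ℓ} (R : CommutativeRing c ℓ) {p q : ℕ} where

  open CommutativeRing R renaming (refl to ≈-refl; trans to ≈-trans; sym to ≈-sym)
  open Algebra.Properties.Ring ring using ([y-z]x≈yx-zx)
  open Algebra.Properties.Semiring.Sum semiring
  open Algebra.Solver.Ring.NaturalCoefficients.Default commutativeSemiring
   
      using (solve; _:=_; _:+_; _:*_)
  open ShiftSum R {p} {q}
  open Relation.Binary.Reasoning.Setoid setoid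

  -- Each `b j` satisfies an equation with a source `d j`. In the combination with coefficients
  -- `c j`, the sources are absorbed by the corrections `e′` at the neighbouring points, so the
  -- corrected combination obeys an equation without source. The left side has no correction: it is
  -- meant for a point where the correction is zero.
  combine-homogeneous : ∀ {n} z (w : Shift p q → Carrier) (c b d : Fin n → Carrier)
    (b′ : Fin n → Shift p q → Carrier) (e′ : Shift p q → Carrier) →
    (∀ j → z * b j ≈ d j + ∑ₛ (λ k → w k * b′ j k)) →
    ∑ₛ (λ k → w k * e′ k) ≈ sum (λ j → c j * d j) →
    z * sum (λ j → c j * b j) ≈ ∑ₛ (λ k → w k * (sum (λ j → c j * b′ j k) + e′ k))
  combine-homogeneous z w c b d b′ e′ b-step e-step = begin
    z * sum (λ j → c j * b j)
      ≈⟨ *-distribˡ-sum z (λ j → c j * b j) ⟩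
    sum (λ j → z * (c j * b j))
      ≈⟨ sum-cong-≋ (λ j → ≈-trans (swap z (c j) (b j)) (≈-trans (*-congˡ (b-step j))
           (≈-trans (distribˡ (c j) _ _) (≈-trans (+-comm _ _) (+-congʳ
             (≈-trans (∑ₛ-*ˡ (c j) (λ k → w k * b′ j k)) (∑ₛ-cong λ k → swap (c j) (w k) (b′ j k)))))))) ⟩
    sum (λ j → ∑ₛ (λ k → w k * (c j * b′ j k)) + c j * d j)
      ≈⟨ ∑-distrib-+ (λ j → ∑ₛ (λ k → w k * (c j * b′ j k))) (λ j → c j * d j) ⟩
    sum (λ j → ∑ₛ (λ k → w k * (c j * b′ j k))) + sum (λ j → c j * d j)
      ≈⟨ +-cong
           (≈-trans (≈-sym (∑ₛ-∑-comm λ k j → w k * (c j * b′ j k)))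
             (∑ₛ-cong λ k → ≈-sym (*-distribˡ-sum (w k) (λ j → c j * b′ j k))))
           (≈-sym e-step) ⟩
    ∑ₛ (λ k → w k * sum (λ j → c j * b′ j k)) + ∑ₛ (λ k → w k * e′ k)
      ≈⟨ ∑ₛ-distrib-+ (λ k → w k * sum (λ j → c j * b′ j k)) (λ k → w k * e′ k) ⟨
    ∑ₛ (λ k → w k * sum (λ j → c j * b′ j k) + w k * e′ k)
      ≈⟨ ∑ₛ-cong (λ k → distribˡ (w k) (sum (λ j → c j * b′ j k)) (e′ k)) ⟨
    ∑ₛ (λ k → w k * (sum (λ j → c j * b′ j k) + e′ k)) ∎
    where
    swap : ∀ x y z → x * (y * z) ≈ y * (x * z)
    swap = solve 3 (λ x y z → x :* (y :* z) := y :* (x :* z)) ≈-refl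

  -- Linearity: a multiple of a solution of the homogeneous equation may be added to a solution with
  -- source `d`.
  combine-inhomogeneous : ∀ z (w : Shift p q → Carrier) s x b d (s′ b′ : Shift p q → Carrier) →
    z * s ≈ ∑ₛ (λ k → w k * s′ k) →
    z * b ≈ d + ∑ₛ (λ k → w k * b′ k) →
    z * (s * x + b) ≈ d + ∑ₛ (λ k → w k * (s′ k * x + b′ k))
  combine-inhomogeneous z w s x b d s′ b′ s-step b-step = begin
    z * (s * x + b)
      ≈⟨ expand z s x b ⟩
    z * s * x + z * b
      ≈⟨ +-cong (*-congʳ s-step) b-step ⟩
    ∑ₛ (λ k → w k * s′ k) * x + (d + ∑ₛ (λ k → w k * b′ k))
      ≈⟨ solve 3 (λ s d b → s :+ (d :+ b) := d :+ (s :+ b)) ≈-refl _ _ _ ⟩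
    d + (∑ₛ (λ k → w k * s′ k) * x + ∑ₛ (λ k → w k * b′ k))
      ≈⟨ +-congˡ (+-congʳ (∑ₛ-*ʳ x (λ k → w k * s′ k))) ⟩
    d + (∑ₛ (λ k → w k * s′ k * x) + ∑ₛ (λ k → w k * b′ k))
      ≈⟨ +-congˡ (∑ₛ-distrib-+ (λ k → w k * s′ k * x) (λ k → w k * b′ k)) ⟨
    d + ∑ₛ (λ k → w k * s′ k * x + w k * b′ k)
      ≈⟨ +-congˡ (∑ₛ-cong λ k → expand (w k) (s′ k) x (b′ k)) ⟨
    d + ∑ₛ (λ k → w k * (s′ k * x + b′ k)) ∎
    where
    expand : ∀ z s x b → z * (s * x + b) ≈ z * s * x + z * b
    expand = solve 4 (λ z s x b → z :* (s :* x :+ b) := z :* s :* x :+ z :* b) ≈-refl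

  -- Elimination of the unknowns `g i`: each is an affine function of `x`, and after substitution
  -- all multiples of `x` are collected on the left.
  solve-for-initial : ∀ z a₀ x d (a₊ : Fin q → Carrier) (a₋ : Fin p → Carrier)
    (B : Fin q → Fin p → Carrier) (g b : Fin q → Carrier) →
    z * x ≈ d + (a₀ * x + sum (λ i → a₊ i * g i)) →
    (∀ i → g i ≈ sum (λ j → a₋ j * B i j) * x + b i) →
    (z - a₀ - sum (λ i → sum (λ j → a₊ i * a₋ j * B i j))) * x ≈ d + sum (λ i → a₊ i * b i)
  solve-for-initial z a₀ x d a₊ a₋ B g b zx g≈ = begin
    (z - a₀ - Q) * x
      ≈⟨ ≈-trans ([y-z]x≈yx-zx x (z - a₀) Q) (+-congʳ ([y-z]x≈yx-zx x z a₀)) ⟩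
    z * x - a₀ * x - Q * x
      ≈⟨ +-congʳ (+-congʳ (≈-trans zx (+-congˡ (+-congˡ up-steps)))) ⟩
    d + (a₀ * x + (Q * x + P)) - a₀ * x - Q * x
      -- The solver works with natural coefficients, so `x′` and `y′` stand for the negated products
      -- and are cancelled separately below.
      ≈⟨ solve 6 (λ d x y p x′ y′ → d :+ (x :+ (y :+ p)) :+ x′ :+ y′ :=
           d :+ p :+ ((x :+ x′) :+ (y :+ y′))) ≈-refl _ _ _ _ _ _ ⟩
    d + P + ((a₀ * x - a₀ * x) + (Q * x - Q * x))
      ≈⟨ +-congˡ (+-cong (-‿inverseʳ (a₀ * x)) (-‿inverseʳ (Q * x))) ⟩
    d + P + (0# + 0#)
      ≈⟨ ≈-trans (+-congˡ (+-identityˡ 0#)) (+-identityʳ _) ⟩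
    d + P ∎
    where
    P = sum (λ i → a₊ i * b i)
    Q = sum (λ i → sum (λ j → a₊ i * a₋ j * B i j))

    S : Fin q → Carrier
    S i = sum (λ j → a₋ j * B i j)

    up-steps : sum (λ i → a₊ i * g i) ≈ Q * x + P
    up-steps = begin
      sum (λ i → a₊ i * g i)
        ≈⟨ sum-cong-≋ (λ i → ≈-trans (*-congˡ (g≈ i))
             (solve 4 (λ w s x b → w :* (s :* x :+ b) := w :* s :* x :+ w :* b) ≈-refl
               (a₊ i) (S i) x (b i))) ⟩
      sum (λ i → a₊ i * S i * x + a₊ i * b i)
        ≈⟨ ∑-distrib-+ (λ i → a₊ i * S i * x) (λ i → a₊ i * b i) ⟩
      sum (λ i → a₊ i * S i * x) + P
        ≈⟨ +-congʳ (*-distribʳ-sum x (λ i → a₊ i * S i)) ⟨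
      sum (λ i → a₊ i * S i) * x + P
        ≈⟨ +-congʳ (*-congʳ (sum-cong-≋ λ i → ≈-trans
             (*-distribˡ-sum (a₊ i) (λ j → a₋ j * B i j))
             (sum-cong-≋ λ j → ≈-sym (*-assoc (a₊ i) (a₋ j) (B i j))))) ⟩
      Q * x + P ∎

  cancelˡ : ∀ {x d y s} → x * d ≈ 1# → d * y ≈ s → y ≈ x * s
  cancelˡ {x} {d} {y} {s} xd≈1 dy≈s = begin
    y           ≈⟨ *-identityˡ y ⟨
    1# * y      ≈⟨ *-congʳ xd≈1 ⟨
    x * d * y   ≈⟨ *-assoc x d y ⟩
    x * (d * y) ≈⟨ *-congˡ dy≈s ⟩
    x * s       ∎

  cancel-middle : ∀ {x d y s t} → x * d ≈ 1# → t ≈ x * s → t * y * d ≈ s * y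
  cancel-middle {x} {d} {y} {s} {t} xd≈1 t≈xs = begin
    t * y * d       ≈⟨ *-congʳ (*-congʳ t≈xs) ⟩
    x * s * y * d
      ≈⟨ solve 4 (λ x s y d → x :* s :* y :* d := (x :* d) :* (s :* y)) ≈-refl x s y d ⟩
    x * d * (s * y) ≈⟨ *-congʳ xd≈1 ⟩
    1# * (s * y)    ≈⟨ *-identityˡ _ ⟩
    s * y           ∎

-- Indicators and sums over lists.

module Indicator {c ℓ} (R : CommutativeRing c ℓ) where

  open CommutativeRing R renaming (refl to ≈-refl; trans to ≈-trans; sym to ≈-sym)

  χ : ∀ {a} {P : Set a} → Dec P → Carrier
  χ (yes _) = 1#
  χ (no _)  = 0#

  χ-yes : ∀ {a} {P : Set a} (P? : Dec P) → P → χ P? ≈ 1#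
  χ-yes (yes _) _ = ≈-refl
  χ-yes (no ¬P) P = contradiction P ¬P

  χ-no : ∀ {a} {P : Set a} (P? : Dec P) → ¬ P → χ P? ≈ 0#
  χ-no (yes P) ¬P = contradiction P ¬P
  χ-no (no _)  _  = ≈-refl

  χ-× : ∀ {a b} {P : Set a} {Q : Set b} (P? : Dec P) (Q? : Dec Q) →
        χ (P? ×-dec Q?) ≈ χ P? * χ Q?
  χ-× (yes _) (yes _) = ≈-sym (*-identityˡ 1#)
  χ-× (yes _) (no _)  = ≈-sym (*-identityˡ 0#)
  χ-× (no _)  _       = ≈-sym (zeroˡ _)

  χ-⇒ : ∀ {a b} {P : Set a} {Q : Set b} (P? : Dec P) (Q? : Dec Q) → (P → Q) → ∀ x →
        χ Q? * (χ P? * x) ≈ χ P? * x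
  χ-⇒ (yes _) (yes _) _   x = *-identityˡ _
  χ-⇒ (yes P) (no ¬Q) P⇒Q x = contradiction (P⇒Q P) ¬Q
  χ-⇒ (no _)  Q?      _   x = ≈-trans (*-congˡ (zeroˡ x)) (≈-trans (zeroʳ _) (≈-sym (zeroˡ x)))

module ListSum {c ℓ} (R : CommutativeRing c ℓ) where

  open CommutativeRing R renaming (refl to ≈-refl; trans to ≈-trans; sym to ≈-sym)
  open Algebra.Properties.Semiring.Sum semiring using (sum)
  open Indicator R

  ∑ₗ : ∀ {a} {A : Set a} → (A → Carrier) → List A → Carrier
  ∑ₗ f xs = foldr _+_ 0# (map f xs)

  ∑ₗ-cong : ∀ {a} {A : Set a} {f g : A → Carrier} → (∀ x → f x ≈ g x) → ∀ xs → ∑ₗ f xs ≈ ∑ₗ g xs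
  ∑ₗ-cong eq []       = ≈-refl
  ∑ₗ-cong eq (x ∷ xs) = +-cong (eq x) (∑ₗ-cong eq xs)

  ∑ₗ-++ : ∀ {a} {A : Set a} (f : A → Carrier) xs ys → ∑ₗ f (xs ++ ys) ≈ ∑ₗ f xs + ∑ₗ f ys
  ∑ₗ-++ f []       ys = ≈-sym (+-identityˡ _)
  ∑ₗ-++ f (x ∷ xs) ys = ≈-trans (+-congˡ (∑ₗ-++ f xs ys)) (≈-sym (+-assoc _ _ _))

  ∑ₗ-map : ∀ {a b} {A : Set a} {B : Set b} (f : B → Carrier) (g : A → B) xs →
           ∑ₗ f (map g xs) ≈ ∑ₗ (f ∘ g) xs
  ∑ₗ-map f g []       = ≈-refl
  ∑ₗ-map f g (x ∷ xs) = +-congˡ (∑ₗ-map f g xs)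

  ∑ₗ-concat : ∀ {a} {A : Set a} (f : A → Carrier) xss → ∑ₗ f (concat xss) ≈ ∑ₗ (∑ₗ f) xss
  ∑ₗ-concat f []         = ≈-refl
  ∑ₗ-concat f (xs ∷ xss) = ≈-trans (∑ₗ-++ f xs (concat xss)) (+-congˡ (∑ₗ-concat f xss))

  ∑ₗ-*ˡ : ∀ {a} {A : Set a} x (f : A → Carrier) xs → ∑ₗ (λ y → x * f y) xs ≈ x * ∑ₗ f xs
  ∑ₗ-*ˡ x f []       = ≈-sym (zeroʳ x)
  ∑ₗ-*ˡ x f (y ∷ ys) = ≈-trans (+-congˡ (∑ₗ-*ˡ x f ys)) (≈-sym (distribˡ x _ _))

  ∑ₗ-filter : ∀ {a b} {A : Set a} {P : Pred A b} (P? : Decidable P) (f : A → Carrier) xs →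
              ∑ₗ f (filter P? xs) ≈ ∑ₗ (λ x → χ (P? x) * f x) xs
  ∑ₗ-filter P? f []       = ≈-refl
  ∑ₗ-filter P? f (x ∷ xs) with P? x
  ... | yes _ = +-cong (≈-sym (*-identityˡ _)) (∑ₗ-filter P? f xs)
  ... | no _  = ≈-trans (∑ₗ-filter P? f xs)
                  (≈-trans (≈-sym (+-identityˡ _)) (+-congʳ (≈-sym (zeroˡ _))))

  ∑ₗ-tabulate : ∀ {a} {A : Set a} (f : A → Carrier) {n} (g : Fin n → A) →
                ∑ₗ f (tabulate g) ≈ sum (f ∘ g)
  ∑ₗ-tabulate f {zero}  g = ≈-refl
  ∑ₗ-tabulate f {suc n} g = +-congˡ (∑ₗ-tabulate f (g ∘ suc))

-- Total weights of paths, computed by their first step.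

module PathSum {c ℓ} (K : CommutativeRing c ℓ) {p q : ℕ}
  (a : Shift p q → ℤ → CommutativeRing.Carrier K) where

  open Paths p q
  open LaurentSeries K
  open LaurentRing K
  open WeightedPaths K a
  open Indicator K
  open ListSum K
  private
    module K where
      open CommutativeRing K public
      open Algebra.Properties.Semiring.Sum semiring public
      open ShiftSum K {p} {q} public
    module L where
      open CommutativeRing laurentRing public
      open Algebra.Properties.Semiring.Sum semiring public
      open ShiftSum laurentRing {p} {q} public
      open LinearRecurrence laurentRing {p} {q} public

  -- The step weight as a function of the shift and the initial height `y`; a down step reads its
  -- sequence at the height where it ends.
  w : Shift p q → ℤ → K.Carrier
  w (up i)   y = a (up i) y
  w (down j) y = a (down j) (y ℤ.+ ⟦ down j ⟧)

  step-weight-w : ∀ {x y} k → step-weight {x , y} (step k refl) ≡ w k y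
  step-weight-w (up _)   = refl
  step-weight-w (down _) = refl

  -- The total weight of the paths of length n from height y to height v that
  -- stay on or above the line of height c.
  T : (c v : ℤ) → ℕ → ℤ → K.Carrier
  T c v zero    y = χ (c ℤ.≤? y) K.* χ (y ℤ.≟ v)
  T c v (suc n) y = χ (c ℤ.≤? y) K.* K.∑ₛ (λ k → w k y K.* T c v n (y ℤ.+ ⟦ k ⟧))

  ∑ₗ-shifts : ∀ f → ∑ₗ f shifts K.≈ K.∑ₛ f
  ∑ₗ-shifts f = K.trans (∑ₗ-++ f (map up (allFin (suc q))) (map down (allFin p)))
    (K.+-cong
      (K.trans (∑ₗ-map f up (allFin (suc q))) (∑ₗ-tabulate (f ∘ up) id))
      (K.trans (∑ₗ-map f down (allFin p)) (∑ₗ-tabulate (f ∘ down) id)))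

  weight-above : ∀ {n u v} → ℤ → Path n u v → K.Carrier
  weight-above c γ = χ (above? c γ) K.* weight γ

  -- Induction on the length by the first step. As `T` records heights only, the final abscissa has
  -- to be tied to `n`: for the empty path, equality of vertices then reduces to equality of
  -- heights.
  ∑-paths : ∀ c v n {x x′} y → n ℕ.+ x ≡ x′ →
    ∑ₗ (weight-above c) (paths n (x , y) (x′ , v)) K.≈ T c v n y
  ∑-paths c v zero {x} {x′} y eq with (x , y) ≟ (x′ , v)
  ... | yes refl = K.trans (K.+-identityʳ _) (K.*-congˡ (K.sym (χ-yes (y ℤ.≟ v) refl)))
  ... | no ≢     = K.sym (K.trans (K.*-congˡ (χ-no (y ℤ.≟ v) λ eq′ → ≢ (cong₂ _,_ eq eq′))) (K.zeroʳ _))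
  ∑-paths c v (suc n) {x} {x′} y eq = begin
    ∑ₗ (weight-above c) (concat (map ext shifts))
      ≈⟨ ∑ₗ-concat (weight-above c) (map ext shifts) ⟩
    ∑ₗ (∑ₗ (weight-above c)) (map ext shifts)
      ≈⟨ ∑ₗ-map (∑ₗ (weight-above c)) ext shifts ⟩
    ∑ₗ (λ k → ∑ₗ (weight-above c) (ext k)) shifts
      ≈⟨ ∑ₗ-cong by-first-step shifts ⟩
    ∑ₗ (λ k → χ (c ℤ.≤? y) K.* (w k y K.* T c v n (y ℤ.+ ⟦ k ⟧))) shifts
      ≈⟨ ∑ₗ-*ˡ _ _ shifts ⟩
    χ (c ℤ.≤? y) K.* ∑ₗ (λ k → w k y K.* T c v n (y ℤ.+ ⟦ k ⟧)) shifts
      ≈⟨ K.*-congˡ (∑ₗ-shifts _) ⟩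
    T c v (suc n) y ∎
    where
    open Relation.Binary.Reasoning.Setoid K.setoid
    open Algebra.Solver.Ring.NaturalCoefficients.Default K.commutativeSemiring
      using (solve; _:=_; _:+_; _:*_)

    ext : Shift p q → List (Path (suc n) (x , y) (x′ , v))
    ext k = map (step k refl ◅_) (paths n (suc x , y ℤ.+ ⟦ k ⟧) (x′ , v))

    by-first-step : ∀ k → ∑ₗ (weight-above c) (ext k) K.≈
                          χ (c ℤ.≤? y) K.* (w k y K.* T c v n (y ℤ.+ ⟦ k ⟧))
    by-first-step k = begin
      ∑ₗ (weight-above c) (ext k)
        ≈⟨ ∑ₗ-map (weight-above c) (step {m = y} k refl ◅_) γs ⟩
      ∑ₗ (λ γ → weight-above c (step k refl ◅ γ)) γs
        ≈⟨ ∑ₗ-cong (λ γ → K.trans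
             (K.*-cong (χ-× (c ℤ.≤? y) (above? c γ)) (K.*-congʳ (K.reflexive (step-weight-w k))))
             (solve 4 (λ s t u v → (s :* t) :* (u :* v) := (s :* u) :* (t :* v)) K.refl _ _ _ _)) γs ⟩
      ∑ₗ (λ γ → (χ (c ℤ.≤? y) K.* w k y) K.* weight-above c γ) γs
        ≈⟨ ∑ₗ-*ˡ _ (weight-above c) γs ⟩
      (χ (c ℤ.≤? y) K.* w k y) K.* ∑ₗ (weight-above c) γs
        ≈⟨ K.*-congˡ (∑-paths c v n (y ℤ.+ ⟦ k ⟧) (≡.trans (ℕ.+-suc n x) eq)) ⟩
      (χ (c ℤ.≤? y) K.* w k y) K.* T c v n (y ℤ.+ ⟦ k ⟧)
        ≈⟨ K.*-assoc _ _ _ ⟩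
      χ (c ℤ.≤? y) K.* (w k y K.* T c v n (y ℤ.+ ⟦ k ⟧)) ∎
      where
      γs = paths n (suc x , y ℤ.+ ⟦ k ⟧) (x′ , v)

  Above-antitone : ∀ {c d n u v} → c ℤ.≤ d → (γ : Path n u v) → Above d γ → Above c γ
  Above-antitone c≤d ε       d≤u       = ℤ.≤-trans c≤d d≤u
  Above-antitone c≤d (_ ◅ γ) (d≤u , A) = ℤ.≤-trans c≤d d≤u , Above-antitone c≤d γ A

  A≈T : ∀ n i j → A[ n , i , j ] K.≈ T 0ℤ (+ j) n (+ i)
  A≈T n i j = K.trans (∑ₗ-filter (above? 0ℤ) weight (paths n (0 , + i) (n , + j)))
    (∑-paths 0ℤ (+ j) n (+ i) (ℕ.+-identityʳ n))

  -- The paths in `𝒟⁽¹⁾` are filtered twice. Staying above height 1 implies staying above height 0,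
  -- so the weaker indicator is absorbed by `χ-⇒`.
  A⁽¹⁾≈T : ∀ n i j → A⁽¹⁾[ n , i , j ] K.≈ T 1ℤ (+ suc j) n (+ suc i)
  A⁽¹⁾≈T n i j = K.trans (∑ₗ-filter (above? 1ℤ) weight (𝒟 n (suc i) (suc j))) (K.trans
    (∑ₗ-filter (above? 0ℤ) (weight-above 1ℤ) γs) (K.trans
    (∑ₗ-cong (λ γ → χ-⇒ (above? 1ℤ γ) (above? 0ℤ γ)
      (Above-antitone (ℤ.+≤+ ℕ.z≤n) γ) (weight γ)) γs)
    (∑-paths 1ℤ (+ suc j) n (+ suc i) (ℕ.+-identityʳ n))))
    where
    γs = paths n (0 , + suc i) (n , + suc j)

  -- Generating functions and the system they satisfy.

  G : (c v : ℤ) → ℤ → Laurent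
  G c v y = generating λ n → T c v n y

  generating-cong : ∀ {s t} → (∀ n → s n K.≈ t n) → generating s ≋ generating t
  generating-cong eq = mk≋ λ { (+ _) → K.refl ; -[1+ n ] → eq n }

  A≋G : ∀ i j → A i j ≋ G 0ℤ (+ j) (+ i)
  A≋G i j = generating-cong λ n → A≈T n i j

  A⁽¹⁾≋G : ∀ i j → A⁽¹⁾ i j ≋ G 1ℤ (+ suc j) (+ suc i)
  A⁽¹⁾≋G i j = generating-cong λ n → A⁽¹⁾≈T n i j

  -- This zero extension lets the first-step equation run over all shifts, with no separate
  -- treatment of steps that fall below the line.
  G-below : ∀ {c v y} → ¬ c ℤ.≤ y → G c v y ≋ 0L
  G-below {c} {v} {y} c≰y = mk≋ λ
    { (+ n)        → K.sym (coeff-0L (+ n))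
    ; -[1+ zero ]  → K.trans (K.*-congʳ (χ-no (c ℤ.≤? y) c≰y)) (K.zeroˡ _)
    ; -[1+ suc _ ] → K.trans (K.*-congʳ (χ-no (c ℤ.≤? y) c≰y)) (K.zeroˡ _) }

  -- The final vertex belongs to the path too, so it cannot lie below the line.
  G-unreachable : ∀ {c v y} → ¬ c ℤ.≤ v → G c v y ≋ 0L
  G-unreachable {c} {v} {y} c≰v = mk≋ λ
    { (+ n)    → K.sym (coeff-0L (+ n))
    ; -[1+ n ] → T≈0 n y }
    where
    T≈0 : ∀ n y → T c v n y K.≈ K.0#
    T≈0 zero    y with y ℤ.≟ v
    ... | yes refl = K.trans (K.*-congʳ (χ-no (c ℤ.≤? y) c≰v)) (K.zeroˡ _)
    ... | no  _    = K.zeroʳ _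
    T≈0 (suc n) y = K.trans
      (K.*-congˡ (K.∑ₛ-zero λ k → K.trans (K.*-congˡ {w k y} (T≈0 n (y ℤ.+ ⟦ k ⟧))) (K.zeroʳ (w k y))))
      (K.zeroʳ _)

  -- The weighted one-step transfer operator.
  W : (ℤ → Laurent) → ℤ → Laurent
  W f y = L.∑ₛ λ k → const (w k y) * f (y ℤ.+ ⟦ k ⟧)

  coeff-sum : ∀ {m} (f : Fin m → Laurent) n → coeff (sum f) n K.≈ K.sum (λ i → coeff (f i) n)
  coeff-sum {zero}  f n = coeff-0L n
  coeff-sum {suc m} f n = K.+-congˡ (coeff-sum (f ∘ suc) n)

  coeff-W : ∀ f y n → coeff (W f y) n K.≈ K.∑ₛ (λ k → w k y K.* coeff (f (y ℤ.+ ⟦ k ⟧)) n)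
  coeff-W f y n = K.trans
    (K.+-cong (coeff-sum (λ i → const (w (up i) y) * f (y ℤ.+ ⟦ up i ⟧)) n)
              (coeff-sum (λ i → const (w (down i) y) * f (y ℤ.+ ⟦ down i ⟧)) n))
    (K.∑ₛ-cong (λ k → coeff-const-* (w k y) (f (y ℤ.+ ⟦ k ⟧)) n))

  δ : ℤ → ℤ → Laurent
  δ v y = const (χ (y ℤ.≟ v))

  G-step : ∀ {c v y} → c ℤ.≤ y → z * G c v y ≋ δ v y + W (G c v) y
  G-step {c} {v} {y} c≤y = mk≋ λ n → K.trans (coeff-z-* (G c v y) n)
    (K.sym (K.trans (K.+-congˡ (coeff-W (G c v) y n)) (K.sym (at n))))
    where
    c≤y? : ∀ x → χ (c ℤ.≤? y) K.* x K.≈ x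
    c≤y? x = K.trans (K.*-congʳ (χ-yes (c ℤ.≤? y) c≤y)) (K.*-identityˡ x)

    no-steps : K.0# K.≈ K.∑ₛ (λ k → w k y K.* K.0#)
    no-steps = K.sym (K.∑ₛ-zero λ k → K.zeroʳ (w k y))

    at : ∀ n → coeff (G c v y) (ℤ.pred n) K.≈
               coeff (δ v y) n K.+ K.∑ₛ (λ k → w k y K.* coeff (G c v (y ℤ.+ ⟦ k ⟧)) n)
    -- The constant coefficient accounts for the empty path; negative exponents account for paths
    -- with at least one step.
    at (+ zero)  = K.trans (c≤y? _) (K.trans (K.sym (K.+-identityʳ _)) (K.+-congˡ no-steps))
    at (+ suc m) = K.trans (K.sym (K.+-identityʳ _)) (K.+-congˡ no-steps)
    at -[1+ m ]  = K.trans (c≤y? _) (K.sym (K.+-identityˡ _))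

  -- Descending induction on the exponent, for all heights at once. Multiplication by `z` raises
  -- exponents while `W` preserves them, so the equations determine the coefficients at `pred n`
  -- from those at `n`. The bounds start the induction: all positive exponents have zero
  -- coefficients.
  unique : (f g h : ℤ → Laurent) →
    (∀ y → bound (f y) ≡ 0) → (∀ y → bound (g y) ≡ 0) →
    (∀ y → ¬ 1ℤ ℤ.≤ y → f y ≋ g y) →
    (∀ y → 1ℤ ℤ.≤ y → z * f y ≋ h y + W f y) →
    (∀ y → 1ℤ ℤ.≤ y → z * g y ≋ h y + W g y) →
    ∀ y → f y ≋ g y
  unique f g h bound-f bound-g low f-step g-step y = mk≋ λ n → agree n y
    where
    next : ∀ n → (∀ y → coeff (f y) n K.≈ coeff (g y) n) →
           ∀ y → coeff (f y) (ℤ.pred n) K.≈ coeff (g y) (ℤ.pred n)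
    next n ih y with 1ℤ ℤ.≤? y
    ... | no  y<1 = coeff-≈ (low y y<1) (ℤ.pred n)
    ... | yes 1≤y = begin
      coeff (f y) (ℤ.pred n)   ≈⟨ coeff-z-* (f y) n ⟨
      coeff (z * f y) n        ≈⟨ coeff-≈ (f-step y 1≤y) n ⟩
      coeff (h y) n K.+ coeff (W f y) n
        ≈⟨ K.+-congˡ (K.trans (coeff-W f y n) (K.trans
             (K.∑ₛ-cong (λ k → K.*-congˡ {w k y} (ih (y ℤ.+ ⟦ k ⟧)))) (K.sym (coeff-W g y n)))) ⟩
      coeff (h y) n K.+ coeff (W g y) n
                               ≈⟨ coeff-≈ (g-step y 1≤y) n ⟨
      coeff (z * g y) n        ≈⟨ coeff-z-* (g y) n ⟩
      coeff (g y) (ℤ.pred n)   ∎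
      where open Relation.Binary.Reasoning.Setoid K.setoid

    vanish⁺ : ∀ f → bound f ≡ 0 → ∀ n → coeff f (+ suc n) K.≈ K.0#
    vanish⁺ f eq n = vanish f _ (subst (λ b → + b ℤ.< + suc n) (≡.sym eq) (ℤ.+<+ (ℕ.s≤s ℕ.z≤n)))

    positive : ∀ n y → coeff (f y) (+ suc n) K.≈ coeff (g y) (+ suc n)
    positive n y = K.trans (vanish⁺ (f y) (bound-f y) n) (K.sym (vanish⁺ (g y) (bound-g y) n))

    agree⁺ : ∀ n y → coeff (f y) (+ n) K.≈ coeff (g y) (+ n)
    -- A bound of 0 still permits a constant coefficient, which therefore needs one application of
    -- the equations at exponent 1.
    agree⁺ zero    = next (+ 1) (positive 0)
    agree⁺ (suc n) = positive n

    agree : ∀ n y → coeff (f y) n K.≈ coeff (g y) n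
    agree (+ n)        = agree⁺ n
    agree -[1+ zero ]  = next (+ 0) (agree⁺ 0)
    agree -[1+ suc n ] = next -[1+ n ] (agree -[1+ n ])

  -- First passage to height 0.

  a₋ : Fin p → Laurent
  a₋ j = const (a (down j) 0ℤ)

  -- The shift `up zero` is the level step, so index `i` stands for a rise by `toℕ i + 1`, just as
  -- `down j` is a drop by `toℕ j + 1`.
  a₊ : Fin q → Laurent
  a₊ i = const (a (up (suc i)) 0ℤ)

  a₀ : Laurent
  a₀ = const (a (up zero) 0ℤ)

  -- The paths from height y that reach height 0 at their last vertex and not before, the empty
  -- path being one of them if y = 0; the weights a₋ j are those of the last steps.
  first-passage : ℤ → Laurent
  first-passage y = sum (λ j → a₋ j * G 1ℤ (+ suc (toℕ j)) y) + δ 0ℤ y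

  const-cong : ∀ {x y} → x K.≈ y → const x ≋ const y
  const-cong eq = mk≋ λ { (+ zero) → eq ; (+ suc _) → K.refl ; -[1+ _ ] → K.refl }

  δ-≢ : ∀ {v y} → ¬ y ≡ v → δ v y ≋ 0L
  δ-≢ {v} {y} y≢v = const-cong (χ-no (y ℤ.≟ v) y≢v)

  δ-refl : ∀ v → δ v v ≋ 1L
  δ-refl v = const-cong (χ-yes (v ℤ.≟ v) refl)

  last-down-step : ∀ y j → const (w (down j) y) * δ 0ℤ (y ℤ.+ ⟦ down j ⟧) ≋
                           a₋ j * δ (+ suc (toℕ j)) y
  last-down-step y j with y ℤ.≟ + suc (toℕ j)
  -- The rewrite makes the final height 0 both in the argument of `δ` and in the index of the
  -- weight, which turns the weight into `a₋ j`.
  ... | yes refl rewrite ℤ.n⊖n≡0 (suc (toℕ j)) = L.refl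
  ... | no  y≢   = L.trans
    (L.*-congˡ (δ-≢ λ y-j≡0 → y≢ (ℤ.i-j≡0⇒i≡j y (+ suc (toℕ j)) y-j≡0)))
    (L.trans (L.zeroʳ _) (L.sym (L.zeroʳ _)))

  1≰⇒≢ : ∀ {y} n → ¬ 1ℤ ℤ.≤ y → ¬ y ≡ + suc n
  1≰⇒≢ n y<1 refl = y<1 (ℤ.+≤+ (ℕ.s≤s ℕ.z≤n))

  1≤⇒≢0 : ∀ {y} → 1ℤ ℤ.≤ y → ¬ y ≡ 0ℤ
  1≤⇒≢0 (ℤ.+≤+ ()) refl

  open Relation.Binary.Reasoning.Setoid L.setoid

  -- The source of `G 1ℤ (+ suc (toℕ j))` sits at height `toℕ j + 1`. With the factor `a₋ j` it
  -- equals the contribution of the single step from there to height 0, which is where the summand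
  -- `δ 0ℤ` of `first-passage` enters `W`.
  first-passage-step : ∀ y → 1ℤ ℤ.≤ y → z * first-passage y ≋ W first-passage y
  first-passage-step y 1≤y = L.trans
    (L.*-congˡ {z} (L.trans (L.+-congˡ (δ-≢ (1≤⇒≢0 1≤y))) (L.+-identityʳ _)))
    (L.combine-homogeneous z (λ k → const (w k y)) a₋ (λ j → b j y)
      (λ j → δ (+ suc (toℕ j)) y) (λ j k → b j (y ℤ.+ ⟦ k ⟧)) (λ k → δ 0ℤ (y ℤ.+ ⟦ k ⟧))
      (λ j → G-step 1≤y)
      (L.trans
        (L.+-cong (L.sum-zero no-up-step) (L.sum-cong-≋ (last-down-step y)))
        (L.+-identityˡ _)))
    where
    b : Fin p → ℤ → Laurent
    b j = G 1ℤ (+ suc (toℕ j))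

    no-up-step : ∀ i → const (w (up i) y) * δ 0ℤ (y ℤ.+ ⟦ up i ⟧) ≋ 0L
    no-up-step i = L.trans
      (L.*-congˡ (δ-≢ (1≤⇒≢0 (ℤ.≤-trans 1≤y (ℤ.i≤i+j y (+ toℕ i)))))) (L.zeroʳ _)

  first-passage-low : ∀ {y} → ¬ 1ℤ ℤ.≤ y → first-passage y ≋ δ 0ℤ y
  first-passage-low y<1 = L.trans
    (L.+-congʳ (L.sum-zero λ j → L.trans (L.*-congˡ (G-below y<1)) (L.zeroʳ (a₋ j))))
    (L.+-identityˡ _)

  -- Needed for the bound hypotheses of `unique`: the bound of a sum with a variable number of terms
  -- does not reduce by computation.
  bound-sum : ∀ {n} (f : Fin n → Laurent) → (∀ i → bound (f i) ≡ 0) → bound (sum f) ≡ 0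
  bound-sum {zero}  f eq = refl
  bound-sum {suc n} f eq rewrite eq zero = bound-sum (f ∘ suc) (eq ∘ suc)

  -- Combinatorially, for `y` at least 0, a path either stays above height 1 or is cut at its first
  -- vertex of height 0. Uniqueness of the solution replaces a bijection of paths.
  first-passage-decomposition : ∀ v y →
    G 0ℤ v y ≋ first-passage y * G 0ℤ v 0ℤ + G 1ℤ v y
  first-passage-decomposition v = unique (G 0ℤ v) (λ y → first-passage y * X + G 1ℤ v y) (δ v)
    (λ _ → refl) bound-decomposed low
    (λ y 1≤y → G-step (ℤ.≤-trans (ℤ.+≤+ ℕ.z≤n) 1≤y))
    λ y 1≤y → L.combine-inhomogeneous z (λ k → const (w k y))
      (first-passage y) X (G 1ℤ v y) (δ v y)
      (λ k → first-passage (y ℤ.+ ⟦ k ⟧)) (λ k → G 1ℤ v (y ℤ.+ ⟦ k ⟧))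
      (first-passage-step y 1≤y) (G-step 1≤y)
    where
    X = G 0ℤ v 0ℤ

    bound-decomposed : ∀ y → bound (first-passage y * X + G 1ℤ v y) ≡ 0
    bound-decomposed y
      rewrite bound-sum (λ j → a₋ j * G 1ℤ (+ suc (toℕ j)) y) (λ _ → refl) = refl

    low : ∀ y → ¬ 1ℤ ℤ.≤ y → G 0ℤ v y ≋ first-passage y * X + G 1ℤ v y
    low y y<1 = L.trans (at y y<1) (L.sym (L.trans
      (L.+-cong (L.*-congʳ (first-passage-low y<1)) (G-below y<1)) (L.+-identityʳ _)))
      where
      at : ∀ y → ¬ 1ℤ ℤ.≤ y → G 0ℤ v y ≋ δ 0ℤ y * X
      at (+ zero)  _   = L.sym (L.trans (L.*-congʳ (δ-refl 0ℤ)) (L.*-identityˡ X))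
      at (+ suc n) y<1 = contradiction refl (1≰⇒≢ n y<1)
      at -[1+ n ]  _   = L.trans (G-below λ ()) (L.sym
        (L.trans (L.*-congʳ (δ-≢ {0ℤ} { -[1+ n ]} λ ())) (L.zeroˡ X)))

  -- The four identities.

  S : ℕ → Laurent
  S i = sum (λ j → a₋ j * A⁽¹⁾ i (toℕ j))

  first-passage≋S : ∀ i → first-passage (+ suc i) ≋ S i
  first-passage≋S i = L.trans
    (L.+-cong (L.sum-cong-≋ λ j → L.*-congˡ {a₋ j} (L.sym (A⁽¹⁾≋G i (toℕ j))))
              (δ-≢ {0ℤ} {+ suc i} λ ()))
    (L.+-identityʳ _)

  denominator : Laurent
  denominator = z - a₀ - sum (λ i → sum (λ j → a₊ i * a₋ j * A⁽¹⁾ (toℕ i) (toℕ j)))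

  denominator-* : ∀ v → denominator * G 0ℤ v 0ℤ ≋
    δ v 0ℤ + sum (λ i → a₊ i * G 1ℤ v (+ suc (toℕ i)))
  denominator-* v = L.solve-for-initial z a₀ X (δ v 0ℤ) a₊ a₋
    (λ i j → A⁽¹⁾ (toℕ i) (toℕ j)) (λ i → G 0ℤ v (+ suc (toℕ i))) (λ i → G 1ℤ v (+ suc (toℕ i)))
    (L.trans (G-step (ℤ.+≤+ ℕ.z≤n)) (L.+-congˡ {δ v 0ℤ} (L.trans
      -- The level step splits off the sum over up steps by computation. Down steps from height 0
      -- end below it, where `G` vanishes.
      (L.+-congˡ (L.sum-zero λ j → L.trans
        (L.*-congˡ (G-below λ ())) (L.zeroʳ (const (w (down j) 0ℤ)))))
      (L.+-identityʳ _))))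
    (λ i → L.trans (first-passage-decomposition v (+ suc (toℕ i)))
      (L.+-congʳ (L.*-congʳ {X} (first-passage≋S (toℕ i)))))
    where
    X = G 0ℤ v 0ℤ

  denominator-A₀₀ : denominator * A 0 0 ≋ 1L
  denominator-A₀₀ = begin
    denominator * A 0 0               ≈⟨ L.*-congˡ (A≋G 0 0) ⟩
    denominator * G 0ℤ 0ℤ 0ℤ          ≈⟨ denominator-* 0ℤ ⟩
    δ 0ℤ 0ℤ + sum (λ i → a₊ i * G 1ℤ 0ℤ (+ suc (toℕ i)))
      ≈⟨ L.+-cong (δ-refl 0ℤ) (L.sum-zero λ i → L.trans
           (L.*-congˡ (G-unreachable λ { (ℤ.+≤+ ()) })) (L.zeroʳ (a₊ i))) ⟩
    1L + 0L                           ≈⟨ L.+-identityʳ 1L ⟩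
    1L ∎

  denominator-A₀ⱼ : ∀ j → denominator * A 0 (suc j) ≋ sum (λ i → a₊ i * A⁽¹⁾ (toℕ i) j)
  denominator-A₀ⱼ j = begin
    denominator * A 0 (suc j)          ≈⟨ L.*-congˡ (A≋G 0 (suc j)) ⟩
    denominator * G 0ℤ (+ suc j) 0ℤ    ≈⟨ denominator-* (+ suc j) ⟩
    δ (+ suc j) 0ℤ + sum (λ i → a₊ i * G 1ℤ (+ suc j) (+ suc (toℕ i)))
      ≈⟨ L.+-cong (δ-≢ {+ suc j} {0ℤ} λ ())
           (L.sum-cong-≋ λ i → L.*-congˡ {a₊ i} (L.sym (A⁽¹⁾≋G (toℕ i) j))) ⟩
    0L + sum (λ i → a₊ i * A⁽¹⁾ (toℕ i) j)
      ≈⟨ L.+-identityˡ _ ⟩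
    sum (λ i → a₊ i * A⁽¹⁾ (toℕ i) j) ∎

  Aᵢ₀ : ∀ i → A (suc i) 0 ≋ A 0 0 * S i
  Aᵢ₀ i = begin
    A (suc i) 0                      ≈⟨ A≋G (suc i) 0 ⟩
    G 0ℤ 0ℤ (+ suc i)                ≈⟨ first-passage-decomposition 0ℤ (+ suc i) ⟩
    first-passage (+ suc i) * G 0ℤ 0ℤ 0ℤ + G 1ℤ 0ℤ (+ suc i)
      ≈⟨ L.+-cong (L.*-cong (first-passage≋S i) (L.sym (A≋G 0 0)))
           (G-unreachable λ { (ℤ.+≤+ ()) }) ⟩
    S i * A 0 0 + 0L                 ≈⟨ L.+-identityʳ _ ⟩
    S i * A 0 0                      ≈⟨ L.*-comm (S i) (A 0 0) ⟩
    A 0 0 * S i ∎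

  Aᵢⱼ : ∀ i j → A (suc i) (suc j) ≋ S i * A 0 (suc j) + A⁽¹⁾ i j
  Aᵢⱼ i j = begin
    A (suc i) (suc j)                ≈⟨ A≋G (suc i) (suc j) ⟩
    G 0ℤ (+ suc j) (+ suc i)         ≈⟨ first-passage-decomposition (+ suc j) (+ suc i) ⟩
    first-passage (+ suc i) * G 0ℤ (+ suc j) 0ℤ + G 1ℤ (+ suc j) (+ suc i)
      ≈⟨ L.+-cong (L.*-cong (first-passage≋S i) (L.sym (A≋G 0 (suc j)))) (L.sym (A⁽¹⁾≋G i j)) ⟩
    S i * A 0 (suc j) + A⁽¹⁾ i j ∎

  A₀₀-denominator : A 0 0 * denominator ≋ 1L
  A₀₀-denominator = L.trans (L.*-comm (A 0 0) denominator) denominator-A₀₀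

  A₀ⱼ : ∀ j → A 0 (suc j) ≋ A 0 0 * sum (λ i → a₊ i * A⁽¹⁾ (toℕ i) j)
  A₀ⱼ j = L.cancelˡ A₀₀-denominator (denominator-A₀ⱼ j)

  -- Division by `A 0 0` is multiplication by its inverse `denominator`, which cancels the factor
  -- `A 0 0` that `Aᵢ₀` exhibits in `A (suc i) 0`.
  Aᵢ₀A₀ⱼ/A₀₀ : ∀ i j → A (suc i) 0 * A 0 (suc j) * denominator ≋ S i * A 0 (suc j)
  Aᵢ₀A₀ⱼ/A₀₀ i j = L.cancel-middle A₀₀-denominator (Aᵢ₀ i)

  -- Quantifying over D allows an instance to be used without comparing its denominator
  -- definitionally with the one above, which is intractable for K = ℂ.
  path-identities : ∀ D → D ≋ denominator →
    (Σ[ d ∈ Invertible D ] A 0 0 ≋ 1L / D [ d ]) ×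
    (∀ j → A 0 (suc j) ≋ A 0 0 * sum (λ i → a₊ i * A⁽¹⁾ (toℕ i) j)) ×
    (∀ i → A (suc i) 0 ≋ A 0 0 * sum (λ j → a₋ j * A⁽¹⁾ i (toℕ j))) ×
    (Σ[ u ∈ Invertible (A 0 0) ] (∀ i j →
      A (suc i) (suc j) ≋ (A (suc i) 0 * A 0 (suc j)) / A 0 0 [ u ] + A⁽¹⁾ i j))
  path-identities D D≋ =
    ( (A 0 0 , L.trans (L.*-congˡ D≋) A₀₀-denominator , L.trans (L.*-congʳ D≋) denominator-A₀₀)
    , L.sym (L.*-identityˡ (A 0 0))) ,
    A₀ⱼ , Aᵢ₀ ,
    ((denominator , denominator-A₀₀ , A₀₀-denominator) , λ i j →
      L.trans (Aᵢⱼ i j) (L.+-congʳ (L.sym (Aᵢ₀A₀ⱼ/A₀₀ i j))))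

theorem2p1 :
    (p q : ℕ) → p ≥ 1 → q ≥ 1 →
    (a : Shift p q → ℤ → ℂ) →
    let open LaurentSeries ℂ-commutativeRing
        open WeightedPaths ℂ-commutativeRing a
        a₀ = const (a (up zero) 0ℤ)
        a₊ = λ (i : Fin q) → const (a (up (suc i)) 0ℤ)
        a₋ = λ (j : Fin p) → const (a (down j) 0ℤ)
        denominator = z - a₀ - sum (λ i → sum (λ j → a₊ i * a₋ j * A⁽¹⁾ (toℕ i) (toℕ j)))
    in
    (Σ[ d ∈ Invertible denominator ] A 0 0 ≋ 1L / denominator [ d ]) ×
    (∀ j → A 0 (suc j) ≋ A 0 0 * sum (λ i → a₊ i * A⁽¹⁾ (toℕ i) j)) ×
    (∀ i → A (suc i) 0 ≋ A 0 0 * sum (λ j → a₋ j * A⁽¹⁾ i (toℕ j))) ×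
    (Σ[ u ∈ Invertible (A 0 0) ] (∀ i j →
      A (suc i) (suc j) ≋ (A (suc i) 0 * A 0 (suc j)) / A 0 0 [ u ] + A⁽¹⁾ i j))
theorem2p1 p q _ _ a =
  PathSum.path-identities ℂ-commutativeRing a _
    (LaurentSeries.mk≋ λ _ → CommutativeRing.refl ℂ-commutativeRing)
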